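{- Define polynomials $\Lambda_k$ in $\lambda$ by $\Lambda_1=\lambda$, $\Lambda_2=\lambda^2-\frac14$, and $\Lambda_k=\lambda\Lambda_{k-1}-\frac14\Lambda_{k-2}$ for every $k\ge 3$. Then for every integer $n\ge 3$, the Randić characteristic polynomial of the cycle graph $C_n$ on $n$ vertices is $$RP(C_n,\lambda)=\lambda\Lambda_{n-1}-\tfrac12\Lambda_{n-2}-\left(\tfrac12\right)^{n-1}.$$
   Context: All graphs are finite and simple. For a graph $G$ with vertices $v_1,\dots,v_n$ of degrees $d_1,\dots,d_n$, the Randić matrix $R(G)$ is the $n\times n$ real symmetric matrix with $(i,j)$-entry $\frac{1}{\sqrt{d_id_j}}$ if $v_i$ and $v_j$ are adjacent, and $0$ otherwise. The Randić characteristic polynomial of $G$ is $RP(G,\lambda)=\det(\lambda I-R(G))$. -}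

module Defs where

open import Algebra.Bundles.Raw using (RawRing)
import Algebra.Definitions.RawMonoid as RawMonoid-definitions
import Algebra.Definitions.RawSemiring as RawSemiring-definitions
open import Data.Bool.Base using (if_then_else_)
open import Data.Empty using (⊥)
open import Data.Fin.Base as Fin using (Fin; toℕ; punchIn)
import Data.Fin.Properties as Fin
open import Data.Integer.Base as ℤ using (+_)
import Data.Integer.Properties as ℤ
open import Data.List.Base as List using (List; []; _∷_)
open import Data.Nat.Base as ℕ using (ℕ; zero; suc)
import Data.Nat.Properties as ℕ
open import Data.Nat.Tactic.RingSolver using (solve-∀)
open import Data.Integer.Tactic.RingSolver using () renaming (solve-∀ to ℤ-solve-∀)
open import Data.Product.Base using (∃; _×_; _,_; proj₁; proj₂)
open import Data.Rational.Base as ℚ using (ℚ; 0ℚ; 1ℚ; ½; ∣_∣)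
import Data.Rational.Properties as ℚ
open import Data.Rational.Solver using (module +-*-Solver)
import Data.Rational.Unnormalised.Base as ℚᵘ
import Data.Rational.Unnormalised.Properties as ℚᵘ
open import Data.Sum.Base using (_⊎_; inj₁; inj₂)
import Data.Vec.Base as Vec
import Data.Vec.Membership.Propositional as Vec
import Data.Vec.Membership.Propositional.Properties as Vec
import Data.Vec.Relation.Unary.Any as Vec
open import Level using (Level; 0ℓ)
open import Relation.Binary.Core using (Rel)
open import Relation.Binary.Definitions using (Decidable; Irreflexive; Symmetric)
open import Relation.Binary.PropositionalEquality
  using (_≡_; refl; sym; trans; cong; cong₂; subst; subst₂)
open import Relation.Nullary.Decidable using (yes; no; does; _×-dec_; _⊎-dec_)
open import Relation.Nullary.Negation using (contradiction)

infix 4 _<ᵠ_ _≤ᵠ_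
_<ᵠ_ _≤ᵠ_ : Rel ℚ 0ℓ
_<ᵠ_ = ℚ._<_
_≤ᵠ_ = ℚ._≤_

half-pos : ∀ {ε} → 0ℚ <ᵠ ε → 0ℚ <ᵠ ½ ℚ.* ε
half-pos {ε} ε>0 =
  ℚ.positive⁻¹ _ {{ℚ.pos*pos⇒pos ½ ε {{ℚ.positive ε>0}}}}

halves : ∀ ε → ½ ℚ.* ε ℚ.+ ½ ℚ.* ε ≡ ε
halves ε = trans (sym (ℚ.*-distribʳ-+ ε ½ ½)) (ℚ.*-identityˡ ε)

∣∣≤ : ∀ {p q e} → p ≤ᵠ q ℚ.+ e → q ≤ᵠ p ℚ.+ e → ∣ p ℚ.- q ∣ ≤ᵠ e
∣∣≤ {p} {q} {e} p≤ q≤ with ℚ.∣p∣≡p∨∣p∣≡-p (p ℚ.- q)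
... | inj₁ eq = subst₂ _≤ᵠ_ (sym eq)
        (solve 2 (λ q e → (q :+ e) :- q := e) refl q e) (ℚ.+-monoˡ-≤ (ℚ.- q) p≤)
  where open +-*-Solver
... | inj₂ eq = subst₂ _≤ᵠ_
        (trans (solve 2 (λ p q → q :- p := :- (p :- q)) refl p q) (sym eq))
        (solve 2 (λ q e → (q :+ e) :- q := e) refl p e) (ℚ.+-monoˡ-≤ (ℚ.- p) q≤)
  where open +-*-Solver

+-pos : ∀ {p q} → 0ℚ <ᵠ p → 0ℚ <ᵠ q → 0ℚ <ᵠ p ℚ.+ q
+-pos {p} {q} p>0 q>0 = ℚ.positive⁻¹ _ {{ℚ.pos+pos⇒pos p {{ℚ.positive p>0}} q {{ℚ.positive q>0}}}}

quotient : ∀ {D ε} → 0ℚ <ᵠ D → 0ℚ <ᵠ ε → ∃ λ δ → 0ℚ <ᵠ δ × D ℚ.* δ ≡ ε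
quotient {D} {ε} D>0 ε>0 = i ℚ.* ε
  , ℚ.positive⁻¹ (i ℚ.* ε) {{ℚ.pos*pos⇒pos i {{ℚ.1/pos⇒pos D}} ε {{ℚ.positive ε>0}}}}
  , trans (sym (ℚ.*-assoc D i ε)) (trans (cong (ℚ._* ε) (ℚ.*-inverseʳ D)) (ℚ.*-identityˡ ε))
  where
  instance
    D⁺ = ℚ.positive D>0
    D≢0 = ℚ.pos⇒nonZero D
  i = ℚ.1/ D

*-small : ∀ {p q D δ} → 0ℚ <ᵠ D → ∣ p ∣ ≤ᵠ D → ∣ q ∣ <ᵠ δ → ∣ p ℚ.* q ∣ <ᵠ D ℚ.* δ
*-small {p} {q} {D} {δ} D>0 p≤ q< = subst (_<ᵠ D ℚ.* δ) (sym (ℚ.∣p*q∣≡∣p∣*∣q∣ p q))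
  (ℚ.≤-<-trans (ℚ.*-monoʳ-≤-nonNeg ∣ q ∣ {{ℚ.∣-∣-nonNeg q}} p≤)
               (ℚ.*-monoʳ-<-pos D {{ℚ.positive D>0}} q<))

*-close : ∀ {a b c d B C δ} → 0ℚ <ᵠ B → 0ℚ <ᵠ C → ∣ a ∣ ≤ᵠ B → ∣ d ∣ ≤ᵠ C →
          ∣ a ℚ.- c ∣ <ᵠ δ → ∣ b ℚ.- d ∣ <ᵠ δ → ∣ a ℚ.* b ℚ.- c ℚ.* d ∣ <ᵠ (B ℚ.+ C) ℚ.* δ
*-close {a} {b} {c} {d} {B} {C} {δ} B>0 C>0 a≤ d≤ a-c b-d = ℚ.≤-<-trans
  (subst (λ t → ∣ t ∣ ≤ᵠ ∣ a ℚ.* (b ℚ.- d) ∣ ℚ.+ ∣ d ℚ.* (a ℚ.- c) ∣)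
    (solve 4 (λ a b c d → a :* (b :- d) :+ d :* (a :- c) := a :* b :- c :* d) refl a b c d)
    (ℚ.∣p+q∣≤∣p∣+∣q∣ (a ℚ.* (b ℚ.- d)) (d ℚ.* (a ℚ.- c))))
  (subst (_ <ᵠ_) (sym (ℚ.*-distribʳ-+ δ B C))
    (ℚ.+-mono-< (*-small {a} {b ℚ.- d} B>0 a≤ b-d) (*-small {d} {a ℚ.- c} C>0 d≤ a-c)))
  where open +-*-Solver

recip : ℚ → ℚ
recip q with q ℚ.≟ 0ℚ
... | yes _   = 0ℚ
... | no  q≢0 = (ℚ.1/ q) {{ℚ.≢-nonZero q≢0}}

recip-inverse : ∀ q → 0ℚ <ᵠ ∣ q ∣ → recip q ℚ.* q ≡ 1ℚ
recip-inverse q ∣q∣>0 with q ℚ.≟ 0ℚ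
... | yes refl = contradiction ∣q∣>0 (ℚ.<-irrefl refl)
... | no  q≢0  = ℚ.*-inverseˡ q {{ℚ.≢-nonZero q≢0}}

inverse-close : ∀ {a b r s δ ε} → 0ℚ <ᵠ δ → 0ℚ <ᵠ ε → r ℚ.* a ≡ 1ℚ → s ℚ.* b ≡ 1ℚ →
                δ ≤ᵠ ∣ a ∣ → δ ≤ᵠ ∣ b ∣ → ∣ b ℚ.- a ∣ <ᵠ ε ℚ.* (δ ℚ.* δ) → ∣ r ℚ.- s ∣ <ᵠ ε
inverse-close {a} {b} {r} {s} {δ} {ε} δ>0 ε>0 ra sb a≥ b≥ h =
  ℚ.*-cancelʳ-<-nonNeg (∣ a ∣ ℚ.* ∣ b ∣)
    {{ℚ.nonNegative (ℚ.≤-trans (ℚ.<⇒≤ (ℚ.positive⁻¹ (δ ℚ.* δ) {{ℚ.pos*pos⇒pos δ δ}})) δδ≤)}}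
    (ℚ.<-≤-trans (subst (_<ᵠ ε ℚ.* (δ ℚ.* δ)) eq h) (ℚ.*-monoˡ-≤-nonNeg ε δδ≤))
  where
  open +-*-Solver
  instance
    δ⁺ = ℚ.positive δ>0
    δ⁰ = ℚ.pos⇒nonNeg δ
    ε⁰ = ℚ.pos⇒nonNeg ε {{ℚ.positive ε>0}}
  δδ≤ : δ ℚ.* δ ≤ᵠ ∣ a ∣ ℚ.* ∣ b ∣
  δδ≤ = ℚ.≤-trans (ℚ.*-monoʳ-≤-nonNeg δ a≥) (ℚ.*-monoˡ-≤-nonNeg ∣ a ∣ {{ℚ.∣-∣-nonNeg a}} b≥)
  diff : b ℚ.- a ≡ (r ℚ.- s) ℚ.* (a ℚ.* b)
  diff = sym (trans
    (solve 4 (λ r s a b → (r :- s) :* (a :* b) := (r :* a) :* b :- (s :* b) :* a) refl r s a b)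
    (cong₂ ℚ._-_ (trans (cong (ℚ._* b) ra) (ℚ.*-identityˡ b))
                 (trans (cong (ℚ._* a) sb) (ℚ.*-identityˡ a))))
  eq : ∣ b ℚ.- a ∣ ≡ ∣ r ℚ.- s ∣ ℚ.* (∣ a ∣ ℚ.* ∣ b ∣)
  eq = trans (cong ∣_∣ diff) (trans (ℚ.∣p*q∣≡∣p∣*∣q∣ (r ℚ.- s) (a ℚ.* b))
         (cong (∣ r ℚ.- s ∣ ℚ.*_) (ℚ.∣p*q∣≡∣p∣*∣q∣ a b)))

/-mono : ∀ a b m n → a ℕ.* suc n ℕ.≤ b ℕ.* suc m → + a ℚ./ suc m ≤ᵠ + b ℚ./ suc n
/-mono a b m n h = ℚ.toℚᵘ-cancel-≤ (begin
  ℚ.toℚᵘ (+ a ℚ./ suc m)  ≃⟨ ℚ.toℚᵘ-fromℚᵘ (ℚᵘ.mkℚᵘ (+ a) m) ⟩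
  ℚᵘ.mkℚᵘ (+ a) m         ≤⟨ ℚᵘ.*≤* (subst₂ ℤ._≤_ (ℤ.pos-* a (suc n)) (ℤ.pos-* b (suc m)) (ℤ.+≤+ h)) ⟩
  ℚᵘ.mkℚᵘ (+ b) n         ≃⟨ ℚ.toℚᵘ-fromℚᵘ (ℚᵘ.mkℚᵘ (+ b) n) ⟨
  ℚ.toℚᵘ (+ b ℚ./ suc n)  ∎)
  where open ℚᵘ.≤-Reasoning

/-+ : ∀ a b n → + (a ℕ.+ b) ℚ./ suc n ≡ (+ a ℚ./ suc n) ℚ.+ (+ b ℚ./ suc n)
/-+ a b n = ℚ.toℚᵘ-injective (begin-equality
  ℚ.toℚᵘ (+ (a ℕ.+ b) ℚ./ suc n)                        ≃⟨ ℚ.toℚᵘ-fromℚᵘ (ℚᵘ.mkℚᵘ (+ (a ℕ.+ b)) n) ⟩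
  ℚᵘ.mkℚᵘ (+ (a ℕ.+ b)) n                               ≃⟨ ℚᵘ.*≡* (lemma (+ a) (+ b) (+ suc n)) ⟩
  ℚᵘ.mkℚᵘ (+ a) n ℚᵘ.+ ℚᵘ.mkℚᵘ (+ b) n                  ≃⟨ ℚᵘ.+-cong (ℚ.toℚᵘ-fromℚᵘ (ℚᵘ.mkℚᵘ (+ a) n)) (ℚ.toℚᵘ-fromℚᵘ (ℚᵘ.mkℚᵘ (+ b) n)) ⟨
  ℚ.toℚᵘ (+ a ℚ./ suc n) ℚᵘ.+ ℚ.toℚᵘ (+ b ℚ./ suc n)    ≃⟨ ℚ.toℚᵘ-homo-+ (+ a ℚ./ suc n) (+ b ℚ./ suc n) ⟨
  ℚ.toℚᵘ ((+ a ℚ./ suc n) ℚ.+ (+ b ℚ./ suc n))          ∎)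
  where
  open ℚᵘ.≤-Reasoning
  lemma : ∀ a b m → (a ℤ.+ b) ℤ.* (m ℤ.* m) ≡ (a ℤ.* m ℤ.+ b ℤ.* m) ℤ.* m
  lemma = ℤ-solve-∀

/-* : ∀ a b m n → + (a ℕ.* b) ℚ./ (suc m ℕ.* suc n) ≡ (+ a ℚ./ suc m) ℚ.* (+ b ℚ./ suc n)
/-* a b m n = ℚ.toℚᵘ-injective (begin-equality
  ℚ.toℚᵘ (+ (a ℕ.* b) ℚ./ (suc m ℕ.* suc n))            ≃⟨ ℚ.toℚᵘ-fromℚᵘ (ℚᵘ.mkℚᵘ (+ (a ℕ.* b)) (n ℕ.+ m ℕ.* suc n)) ⟩
  ℚᵘ.mkℚᵘ (+ (a ℕ.* b)) (n ℕ.+ m ℕ.* suc n)             ≃⟨ ℚᵘ.*≡* (cong (ℤ._* (+ (suc m ℕ.* suc n))) (ℤ.pos-* a b)) ⟩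
  ℚᵘ.mkℚᵘ (+ a) m ℚᵘ.* ℚᵘ.mkℚᵘ (+ b) n                  ≃⟨ ℚᵘ.*-cong (ℚ.toℚᵘ-fromℚᵘ (ℚᵘ.mkℚᵘ (+ a) m)) (ℚ.toℚᵘ-fromℚᵘ (ℚᵘ.mkℚᵘ (+ b) n)) ⟨
  ℚ.toℚᵘ (+ a ℚ./ suc m) ℚᵘ.* ℚ.toℚᵘ (+ b ℚ./ suc n)    ≃⟨ ℚ.toℚᵘ-homo-* (+ a ℚ./ suc m) (+ b ℚ./ suc n) ⟨
  ℚ.toℚᵘ ((+ a ℚ./ suc m) ℚ.* (+ b ℚ./ suc n))          ∎)
  where open ℚᵘ.≤-Reasoning

archimedean : ∀ c {ε} → 0ℚ <ᵠ ε → ∃ λ N → ∀ n → N ℕ.≤ n → + c ℚ./ suc n <ᵠ ε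
archimedean c {ε@(ℚ.mkℚ (ℤ.+[1+ p ]) d _)} _ = suc c ℕ.* suc d , λ n N≤n →
  ℚ.toℚᵘ-cancel-< (begin-strict
    ℚ.toℚᵘ (+ c ℚ./ suc n)  ≃⟨ ℚ.toℚᵘ-fromℚᵘ (ℚᵘ.mkℚᵘ (+ c) n) ⟩
    ℚᵘ.mkℚᵘ (+ c) n         <⟨ ℚᵘ.*<* (subst₂ ℤ._<_ (ℤ.pos-* c (suc d)) (ℤ.pos-* (suc p) (suc n)) (ℤ.+<+ (bound n N≤n))) ⟩
    ℚ.toℚᵘ ε                ∎)
  where
  open ℚᵘ.≤-Reasoning
  bound : ∀ n → suc c ℕ.* suc d ℕ.≤ n → c ℕ.* suc d ℕ.< suc p ℕ.* suc n
  bound n N≤n = ℕ.≤-trans (ℕ.+-monoˡ-≤ (c ℕ.* suc d) (ℕ.s≤s (ℕ.z≤n {d})))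
    (ℕ.≤-trans N≤n (ℕ.≤-trans (ℕ.n≤1+n n) (ℕ.m≤m+n (suc n) (p ℕ.* suc n))))
archimedean c {ℚ.mkℚ (+ 0) _ _} (ℚ.*<* (ℤ.+<+ ()))
archimedean c {ℚ.mkℚ (ℤ.-[1+ _ ]) _ _} (ℚ.*<* ())

-- Real numbers: Cauchy sequences of rationals.  The existential carries a
-- modulus of convergence; equality of reals is _≈ᴿ_, not _≡_.

IsCauchy : (ℕ → ℚ) → Set
IsCauchy s = ∀ ε → 0ℚ <ᵠ ε → ∃ λ N → ∀ m n → N ℕ.≤ m → N ℕ.≤ n → ∣ s m ℚ.- s n ∣ <ᵠ ε

record ℝ : Set where
  constructor mkℝ
  field
    seq    : ℕ → ℚ
    cauchy : IsCauchy seq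

open ℝ public

infix 4 _≈ᴿ_

_≈ᴿ_ : Rel ℝ 0ℓ
x ≈ᴿ y = ∀ ε → 0ℚ <ᵠ ε → ∃ λ N → ∀ n → N ℕ.≤ n → ∣ seq x n ℚ.- seq y n ∣ <ᵠ ε

fromℚ : ℚ → ℝ
fromℚ q = mkℝ (λ _ → q) λ ε ε>0 → 0 , λ _ _ _ _ →
  subst (_<ᵠ ε) (cong ∣_∣ (sym (ℚ.+-inverseʳ q))) ε>0

infixl 6 _+ᴿ_
infixl 7 _*ᴿ_
infix  8 -ᴿ_

_+ᴿ_ : ℝ → ℝ → ℝ
x +ᴿ y = mkℝ (λ n → seq x n ℚ.+ seq y n) cau
  where
  open +-*-Solver
  cau : IsCauchy (λ n → seq x n ℚ.+ seq y n)
  cau ε ε>0 with cauchy x _ (half-pos ε>0) | cauchy y _ (half-pos ε>0)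
  ... | N , hx | M , hy = N ℕ.⊔ M , λ m n m≥ n≥ →
    let a = seq x m ; b = seq y m ; c = seq x n ; d = seq y n in
    ℚ.≤-<-trans
      (subst (λ t → ∣ t ∣ ≤ᵠ ∣ a ℚ.- c ∣ ℚ.+ ∣ b ℚ.- d ∣)
        (solve 4 (λ a b c d → (a :- c) :+ (b :- d) := (a :+ b) :- (c :+ d)) refl a b c d)
        (ℚ.∣p+q∣≤∣p∣+∣q∣ (a ℚ.- c) (b ℚ.- d)))
      (subst (∣ a ℚ.- c ∣ ℚ.+ ∣ b ℚ.- d ∣ <ᵠ_) (halves ε)
        (ℚ.+-mono-< (hx m n (ℕ.m⊔n≤o⇒m≤o N M m≥) (ℕ.m⊔n≤o⇒m≤o N M n≥))
                    (hy m n (ℕ.m⊔n≤o⇒n≤o N M m≥) (ℕ.m⊔n≤o⇒n≤o N M n≥))))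

-ᴿ_ : ℝ → ℝ
-ᴿ x = mkℝ (λ n → ℚ.- seq x n) λ ε ε>0 → let N , h = cauchy x ε ε>0 in
  N , λ m n m≥ n≥ → subst (_<ᵠ ε)
    (trans (sym (ℚ.∣-p∣≡∣p∣ (seq x m ℚ.- seq x n)))
      (cong ∣_∣ (ℚ.neg-distrib-+ (seq x m) (ℚ.- seq x n))))
    (h m n m≥ n≥)

bounded : ∀ x → ∃ λ B → 0ℚ <ᵠ B × ∃ λ N → ∀ n → N ℕ.≤ n → ∣ seq x n ∣ ≤ᵠ B
bounded x with cauchy x 1ℚ (ℚ.positive⁻¹ 1ℚ)
... | N , h = ∣ c ∣ ℚ.+ 1ℚ , ℚ.+-mono-≤-< (ℚ.0≤∣p∣ c) (ℚ.positive⁻¹ 1ℚ) , N , λ n n≥ →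
  subst (λ t → ∣ t ∣ ≤ᵠ ∣ c ∣ ℚ.+ 1ℚ)
    (solve 2 (λ c a → c :+ (a :- c) := a) refl c (seq x n))
    (ℚ.≤-trans (ℚ.∣p+q∣≤∣p∣+∣q∣ c (seq x n ℚ.- c))
      (ℚ.+-monoʳ-≤ ∣ c ∣ (ℚ.<⇒≤ (h n N n≥ ℕ.≤-refl))))
  where
  open +-*-Solver
  c = seq x N

*-cauchy : ∀ x y {B C δ N₁ N₂ N₃ N₄} → 0ℚ <ᵠ B → 0ℚ <ᵠ C →
  (∀ n → N₁ ℕ.≤ n → ∣ seq x n ∣ ≤ᵠ B) → (∀ n → N₂ ℕ.≤ n → ∣ seq y n ∣ ≤ᵠ C) →
  (∀ m n → N₃ ℕ.≤ m → N₃ ℕ.≤ n → ∣ seq x m ℚ.- seq x n ∣ <ᵠ δ) →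
  (∀ m n → N₄ ℕ.≤ m → N₄ ℕ.≤ n → ∣ seq y m ℚ.- seq y n ∣ <ᵠ δ) →
  ∃ λ N → ∀ m n → N ℕ.≤ m → N ℕ.≤ n →
    ∣ seq x m ℚ.* seq y m ℚ.- seq x n ℚ.* seq y n ∣ <ᵠ (B ℚ.+ C) ℚ.* δ
*-cauchy x y {N₁ = N₁} {N₂} {N₃} {N₄} B>0 C>0 hB hC hx hy =
  N₁ ℕ.⊔ N₂ ℕ.⊔ N₃ ℕ.⊔ N₄ , λ m n m≥ n≥ →
    let m≥₃ = ℕ.m⊔n≤o⇒m≤o (N₁ ℕ.⊔ N₂ ℕ.⊔ N₃) N₄ m≥
        n≥₃ = ℕ.m⊔n≤o⇒m≤o (N₁ ℕ.⊔ N₂ ℕ.⊔ N₃) N₄ n≥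
    in *-close {seq x m} {seq y m} {seq x n} {seq y n} B>0 C>0
         (hB m (ℕ.m⊔n≤o⇒m≤o N₁ N₂ (ℕ.m⊔n≤o⇒m≤o (N₁ ℕ.⊔ N₂) N₃ m≥₃)))
         (hC n (ℕ.m⊔n≤o⇒n≤o N₁ N₂ (ℕ.m⊔n≤o⇒m≤o (N₁ ℕ.⊔ N₂) N₃ n≥₃)))
         (hx m n (ℕ.m⊔n≤o⇒n≤o (N₁ ℕ.⊔ N₂) N₃ m≥₃) (ℕ.m⊔n≤o⇒n≤o (N₁ ℕ.⊔ N₂) N₃ n≥₃))
         (hy m n (ℕ.m⊔n≤o⇒n≤o (N₁ ℕ.⊔ N₂ ℕ.⊔ N₃) N₄ m≥) (ℕ.m⊔n≤o⇒n≤o (N₁ ℕ.⊔ N₂ ℕ.⊔ N₃) N₄ n≥))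

_*ᴿ_ : ℝ → ℝ → ℝ
x *ᴿ y = mkℝ (λ n → seq x n ℚ.* seq y n) λ ε ε>0 →
  let B , B>0 , _ , hB = bounded x
      C , C>0 , _ , hC = bounded y
      δ , δ>0 , total  = quotient {B ℚ.+ C} {ε} (+-pos B>0 C>0) ε>0
      N , h = *-cauchy x y {B} {C} {δ} B>0 C>0 hB hC (proj₂ (cauchy x δ δ>0)) (proj₂ (cauchy y δ δ>0))
  in N , λ m n m≥ n≥ →
    subst (∣ seq x m ℚ.* seq y m ℚ.- seq x n ℚ.* seq y n ∣ <ᵠ_) total (h m n m≥ n≥)

ℝ-rawRing : RawRing 0ℓ 0ℓ
ℝ-rawRing = record
  { Carrier = ℝ ; _≈_ = _≈ᴿ_ ; _+_ = _+ᴿ_ ; _*_ = _*ᴿ_ ; -_ = -ᴿ_ ; 0# = fromℚ 0ℚ ; 1# = fromℚ 1ℚ }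

infix 4 _#0

-- Apartness from 0: from some index on, the terms stay at distance ≥ δ > 0 from 0.
_#0 : ℝ → Set
x #0 = ∃ λ δ → 0ℚ <ᵠ δ × ∃ λ N → ∀ n → N ℕ.≤ n → δ ≤ᵠ ∣ seq x n ∣

-- The finitely many terms of a nonzero real that may vanish are sent to 0 by recip.
inverse : (x : ℝ) → x #0 → ℝ
inverse x (δ , δ>0 , N₀ , hδ) = mkℝ (λ n → recip (seq x n)) cau
  where
  instance
    δ⁺ = ℚ.positive δ>0
    δδ⁺ = ℚ.pos*pos⇒pos δ δ
  inv : ∀ n → N₀ ℕ.≤ n → recip (seq x n) ℚ.* seq x n ≡ 1ℚ
  inv n n≥ = recip-inverse (seq x n) (ℚ.<-≤-trans δ>0 (hδ n n≥))
  cau : IsCauchy (λ n → recip (seq x n))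
  cau ε ε>0 with cauchy x (ε ℚ.* (δ ℚ.* δ))
                   (ℚ.positive⁻¹ _ {{ℚ.pos*pos⇒pos ε {{ℚ.positive ε>0}} (δ ℚ.* δ)}})
  ... | N , h = N₀ ℕ.⊔ N , λ m n m≥ n≥ →
    let m≥₀ = ℕ.m⊔n≤o⇒m≤o N₀ N m≥
        n≥₀ = ℕ.m⊔n≤o⇒m≤o N₀ N n≥
    in inverse-close {seq x m} {seq x n} {recip (seq x m)} {recip (seq x n)} {δ} {ε} δ>0 ε>0 (inv m m≥₀) (inv n n≥₀) (hδ m m≥₀) (hδ n n≥₀)
         (h n m (ℕ.m⊔n≤o⇒n≤o N₀ N n≥) (ℕ.m⊔n≤o⇒n≤o N₀ N m≥))

inverseˡ : ∀ x x#0 → inverse x x#0 *ᴿ x ≈ᴿ fromℚ 1ℚ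
inverseˡ x (δ , δ>0 , N , hδ) ε ε>0 = N , λ n n≥ →
  subst (λ t → ∣ t ∣ <ᵠ ε)
    (sym (trans (cong (ℚ._- 1ℚ) (recip-inverse (seq x n) (ℚ.<-≤-trans δ>0 (hδ n n≥)))) (ℚ.+-inverseʳ 1ℚ)))
    ε>0

⌊√_⌋ : ℕ → ℕ
⌊√ zero ⌋  = 0
⌊√ suc n ⌋ with suc ⌊√ n ⌋ ℕ.* suc ⌊√ n ⌋ ℕ.≤? suc n
... | yes _ = suc ⌊√ n ⌋
... | no  _ = ⌊√ n ⌋

⌊√⌋-lower : ∀ n → ⌊√ n ⌋ ℕ.* ⌊√ n ⌋ ℕ.≤ n
⌊√⌋-lower zero = ℕ.z≤n
⌊√⌋-lower (suc n) with suc ⌊√ n ⌋ ℕ.* suc ⌊√ n ⌋ ℕ.≤? suc n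
... | yes h = h
... | no  _ = ℕ.m≤n⇒m≤1+n (⌊√⌋-lower n)

⌊√⌋-upper : ∀ n → n ℕ.< suc ⌊√ n ⌋ ℕ.* suc ⌊√ n ⌋
⌊√⌋-upper zero = ℕ.s≤s ℕ.z≤n
⌊√⌋-upper (suc n) with suc ⌊√ n ⌋ ℕ.* suc ⌊√ n ⌋ ℕ.≤? suc n
... | yes _ = ℕ.<-≤-trans (ℕ.s<s (⌊√⌋-upper n))
                (ℕ.*-mono-< (ℕ.n<1+n (suc ⌊√ n ⌋)) (ℕ.n<1+n (suc ⌊√ n ⌋)))
... | no  h = ℕ.≰⇒> h

square-cancel-< : ∀ {a b} → a ℕ.* a ℕ.< b ℕ.* b → a ℕ.< b
square-cancel-< {a} {b} h with a ℕ.<? b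
... | yes a<b = a<b
... | no  a≮b = contradiction (ℕ.*-mono-≤ (ℕ.≮⇒≥ a≮b) (ℕ.≮⇒≥ a≮b)) (ℕ.<⇒≱ h)

-- ⌊√(d(n+1)²)⌋ / (n+1) approximates √d from below with error at most 1/(n+1).
√-seq : ℕ → ℕ → ℚ
√-seq d n = + ⌊√ d ℕ.* (suc n ℕ.* suc n) ⌋ ℚ./ suc n

√-seq-step : ∀ d m n → √-seq d m ≤ᵠ √-seq d n ℚ.+ + 1 ℚ./ suc n
√-seq-step d m n = subst (√-seq d m ≤ᵠ_)
  (trans (cong (λ k → + k ℚ./ suc n) (ℕ.+-comm 1 b)) (/-+ b 1 n))
  (/-mono a (suc b) m n (ℕ.<⇒≤ (square-cancel-< (begin-strict
    (a ℕ.* N) ℕ.* (a ℕ.* N)          ≡⟨ swap a N ⟩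
    (a ℕ.* a) ℕ.* (N ℕ.* N)          ≤⟨ ℕ.*-monoˡ-≤ (N ℕ.* N) (⌊√⌋-lower (d ℕ.* (M ℕ.* M))) ⟩
    d ℕ.* (M ℕ.* M) ℕ.* (N ℕ.* N)    ≡⟨ comm d (M ℕ.* M) (N ℕ.* N) ⟩
    d ℕ.* (N ℕ.* N) ℕ.* (M ℕ.* M)    <⟨ ℕ.*-monoˡ-< (M ℕ.* M) (⌊√⌋-upper (d ℕ.* (N ℕ.* N))) ⟩
    (suc b ℕ.* suc b) ℕ.* (M ℕ.* M)  ≡⟨ swap (suc b) M ⟨
    (suc b ℕ.* M) ℕ.* (suc b ℕ.* M)  ∎))))
  where
  open ℕ.≤-Reasoning
  M = suc m
  N = suc n
  a = ⌊√ d ℕ.* (M ℕ.* M) ⌋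
  b = ⌊√ d ℕ.* (N ℕ.* N) ⌋
  swap : ∀ a N → (a ℕ.* N) ℕ.* (a ℕ.* N) ≡ (a ℕ.* a) ℕ.* (N ℕ.* N)
  swap = solve-∀
  comm : ∀ d x y → d ℕ.* x ℕ.* y ≡ d ℕ.* y ℕ.* x
  comm = solve-∀

√_ : ℕ → ℝ
√ d = mkℝ (√-seq d) λ ε ε>0 →
  let N , small = archimedean 1 ε>0
      step = λ m n → λ (n≥ : N ℕ.≤ n) →
        ℚ.≤-trans (√-seq-step d m n) (ℚ.+-monoʳ-≤ (√-seq d n) (1/-anti N n n≥))
  in N , λ m n m≥ n≥ → ℚ.≤-<-trans (∣∣≤ {√-seq d m} {√-seq d n} (step m n n≥) (step n m m≥)) (small N ℕ.≤-refl)
  where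
  1/-anti : ∀ N n → N ℕ.≤ n → + 1 ℚ./ suc n ≤ᵠ + 1 ℚ./ suc N
  1/-anti N n h = /-mono 1 1 n N (ℕ.*-monoʳ-≤ 1 (ℕ.s≤s h))

√-nonNeg : ∀ d n → 0ℚ ≤ᵠ seq (√ d) n
√-nonNeg d n = /-mono 0 ⌊√ d ℕ.* (suc n ℕ.* suc n) ⌋ 0 n ℕ.z≤n

√-square : ∀ d → √ d *ᴿ √ d ≈ᴿ fromℚ (+ d ℚ./ 1)
√-square d ε ε>0 = let N , small = archimedean c ε>0 in
  N , λ n n≥ → ℚ.≤-<-trans (∣∣≤ {√-seq d n ℚ.* √-seq d n} {+ d ℚ./ 1} (upper n) (lower n)) (small n n≥)
  where
  open ℕ.≤-Reasoning
  c = suc (d ℕ.+ d)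
  upper : ∀ n → √-seq d n ℚ.* √-seq d n ≤ᵠ + d ℚ./ 1 ℚ.+ + c ℚ./ suc n
  upper n = ℚ.≤-trans
    (subst (_≤ᵠ + d ℚ./ 1) (/-* a a n n)
      (/-mono (a ℕ.* a) d (n ℕ.+ n ℕ.* suc n) 0
        (subst (ℕ._≤ d ℕ.* (suc n ℕ.* suc n)) (sym (ℕ.*-identityʳ (a ℕ.* a)))
          (⌊√⌋-lower (d ℕ.* (suc n ℕ.* suc n))))))
    (subst (_≤ᵠ + d ℚ./ 1 ℚ.+ + c ℚ./ suc n) (ℚ.+-identityʳ (+ d ℚ./ 1))
      (ℚ.+-monoʳ-≤ (+ d ℚ./ 1) (/-mono 0 c 0 n ℕ.z≤n)))
    where a = ⌊√ d ℕ.* (suc n ℕ.* suc n) ⌋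
  lower : ∀ n → + d ℚ./ 1 ≤ᵠ √-seq d n ℚ.* √-seq d n ℚ.+ + c ℚ./ suc n
  lower n = subst (+ d ℚ./ 1 ≤ᵠ_)
    (trans (/-+ (a ℕ.* a) (c ℕ.* M) (n ℕ.+ n ℕ.* suc n))
      (cong₂ ℚ._+_ (/-* a a n n) (trans (/-* c M n n)
        (trans (cong ((+ c ℚ./ M) ℚ.*_) (ℚ.≤-antisym (/-mono M 1 n 0 (ℕ.≤-reflexive (ℕ.*-comm M 1)))
                                                     (/-mono 1 M 0 n (ℕ.≤-reflexive (ℕ.*-comm 1 M)))))
          (ℚ.*-identityʳ (+ c ℚ./ M))))))
    (/-mono d (a ℕ.* a ℕ.+ c ℕ.* M) 0 (n ℕ.+ n ℕ.* suc n) (begin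
      d ℕ.* (M ℕ.* M)                 ≤⟨ ℕ.≤-pred (⌊√⌋-upper (d ℕ.* (M ℕ.* M))) ⟩
      a ℕ.+ a ℕ.* suc a               ≡⟨ expand a ⟩
      a ℕ.* a ℕ.+ (a ℕ.+ a)           ≤⟨ ℕ.+-monoʳ-≤ (a ℕ.* a) (ℕ.+-mono-≤ a≤dM a≤dM) ⟩
      a ℕ.* a ℕ.+ (d ℕ.* M ℕ.+ d ℕ.* M) ≡⟨ cong (a ℕ.* a ℕ.+_) (ℕ.*-distribʳ-+ M d d) ⟨
      a ℕ.* a ℕ.+ (d ℕ.+ d) ℕ.* M     ≤⟨ ℕ.+-monoʳ-≤ (a ℕ.* a) (ℕ.*-monoˡ-≤ M (ℕ.n≤1+n (d ℕ.+ d))) ⟩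
      a ℕ.* a ℕ.+ c ℕ.* M             ≡⟨ ℕ.*-identityʳ _ ⟨
      (a ℕ.* a ℕ.+ c ℕ.* M) ℕ.* 1     ∎))
    where
    M = suc n
    a = ⌊√ d ℕ.* (M ℕ.* M) ⌋
    expand : ∀ a → a ℕ.+ a ℕ.* suc a ≡ a ℕ.* a ℕ.+ (a ℕ.+ a)
    expand = solve-∀
    shuffle : ∀ d M → d ℕ.* d ℕ.* (M ℕ.* M) ≡ (d ℕ.* M) ℕ.* (d ℕ.* M)
    shuffle = solve-∀
    d≤dd : ∀ d → d ℕ.≤ d ℕ.* d
    d≤dd zero    = ℕ.z≤n
    d≤dd (suc d) = ℕ.m≤m*n (suc d) (suc d)
    a≤dM : a ℕ.≤ d ℕ.* M
    a≤dM = ℕ.≤-pred (square-cancel-< (ℕ.≤-<-trans (begin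
      a ℕ.* a                    ≤⟨ ⌊√⌋-lower (d ℕ.* (M ℕ.* M)) ⟩
      d ℕ.* (M ℕ.* M)            ≤⟨ ℕ.*-monoˡ-≤ (M ℕ.* M) (d≤dd d) ⟩
      d ℕ.* d ℕ.* (M ℕ.* M)      ≡⟨ shuffle d M ⟩
      (d ℕ.* M) ℕ.* (d ℕ.* M)    ∎)
      (ℕ.*-mono-< (ℕ.n<1+n (d ℕ.* M)) (ℕ.n<1+n (d ℕ.* M)))))

√-#0 : ∀ d .{{_ : ℕ.NonZero d}} → √ d #0
√-#0 d = 1ℚ , ℚ.positive⁻¹ 1ℚ , 0 , λ n _ →
  subst (1ℚ ≤ᵠ_) (sym (ℚ.0≤p⇒∣p∣≡p (√-nonNeg d n))) (lower n)
  where
  lower : ∀ n → 1ℚ ≤ᵠ √-seq d n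
  lower n = /-mono 1 a 0 n
    (subst₂ ℕ._≤_ (ℕ.+-comm 0 (suc n)) (sym (ℕ.*-identityʳ a))
      (ℕ.≤-pred (square-cancel-< {suc n} {suc a}
        (ℕ.≤-<-trans (ℕ.m≤n*m (suc n ℕ.* suc n) d) (⌊√⌋-upper (d ℕ.* (suc n ℕ.* suc n)))))))
    where a = ⌊√ d ℕ.* (suc n ℕ.* suc n) ⌋

1/√_ : ∀ d → .{{ℕ.NonZero d}} → ℝ
1/√ d = inverse (√ d) (√-#0 d)

-- Polynomials in one variable λ: lists of coefficients, constant term
-- first.  Trailing zeros are allowed, so equality compares coefficients.

module Polynomial {c ℓ : Level} (R : RawRing c ℓ) where

  private module R = RawRing R

  Poly : Set c
  Poly = List R.Carrier

  coeff : Poly → ℕ → R.Carrier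
  coeff []      _       = R.0#
  coeff (a ∷ p) zero    = a
  coeff (a ∷ p) (suc k) = coeff p k

  infix 4 _≈ₚ_
  _≈ₚ_ : Rel Poly ℓ
  p ≈ₚ q = ∀ k → coeff p k R.≈ coeff q k

  infixl 6 _+ₚ_
  _+ₚ_ : Poly → Poly → Poly
  []      +ₚ q       = q
  (a ∷ p) +ₚ []      = a ∷ p
  (a ∷ p) +ₚ (b ∷ q) = (a R.+ b) ∷ (p +ₚ q)

  infixl 7 _*ₚ_
  _*ₚ_ : Poly → Poly → Poly
  []      *ₚ q = []
  (a ∷ p) *ₚ q = List.map (a R.*_) q +ₚ (R.0# ∷ (p *ₚ q))

  const : R.Carrier → Poly
  const a = a ∷ []

  var : Poly
  var = R.0# ∷ R.1# ∷ []

  rawRing : RawRing c ℓ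
  rawRing = record
    { Carrier = Poly ; _≈_ = _≈ₚ_ ; _+_ = _+ₚ_ ; _*_ = _*ₚ_
    ; -_ = List.map (R.-_) ; 0# = [] ; 1# = const R.1# }

Matrix : ∀ {a} → Set a → ℕ → Set a
Matrix A n = Fin n → Fin n → A

module Determinant {c ℓ : Level} (R : RawRing c ℓ) where

  open RawRing R
  open RawMonoid-definitions +-rawMonoid using (sum)
  open RawSemiring-definitions rawSemiring using (_^_)

  -- Laplace expansion along the first row.
  det : ∀ {n} → Matrix Carrier n → Carrier
  det {zero}  A = 1#
  det {suc n} A = sum λ j →
    (- 1#) ^ toℕ j * A Fin.zero j * det (λ r c → A (Fin.suc r) (punchIn j c))

open Polynomial ℝ-rawRing public using (const) renaming (Poly to ℝ[λ]; var to λ′)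

ℝ[λ]-rawRing : RawRing 0ℓ 0ℓ
ℝ[λ]-rawRing = Polynomial.rawRing ℝ-rawRing

open RawRing ℝ[λ]-rawRing public using (_≈_; _+_; _*_; -_; 0#; 1#)
open RawSemiring-definitions (RawRing.rawSemiring ℝ[λ]-rawRing) public using (_^_)

infixl 6 _-_
_-_ : ℝ[λ] → ℝ[λ] → ℝ[λ]
p - q = p + (- q)

scalarMatrix : ∀ {n} → ℝ[λ] → Matrix ℝ[λ] n
scalarMatrix p i j = if does (i Fin.≟ j) then p else 0#

charPoly : ∀ {n} → Matrix ℝ n → ℝ[λ]
charPoly A = Determinant.det ℝ[λ]-rawRing λ i j → scalarMatrix λ′ i j - const (A i j)

record Graph (n : ℕ) : Set₁ where
  field
    Adj        : Rel (Fin n) 0ℓ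
    adjacent?  : Decidable Adj
    symmetric  : Symmetric Adj
    loopless   : Irreflexive _≡_ Adj

  degree : Fin n → ℕ
  degree i = Vec.count (adjacent? i) (Vec.allFin n)

  degree-nonZero : ∀ {i j} → Adj i j → ℕ.NonZero (degree i)
  degree-nonZero {i} {j} ij = positive (Vec.∈-allFin⁺ j)
    where
    positive : ∀ {m} {v : Vec.Vec (Fin n) m} → j Vec.∈ v → ℕ.NonZero (Vec.count (adjacent? i) v)
    positive {v = k Vec.∷ v} j∈v with adjacent? i k | j∈v
    ... | yes _  | _               = _
    ... | no ¬ik | Vec.here refl   = contradiction ij ¬ik
    ... | no _   | Vec.there j∈v′  = positive j∈v′

-- Adjacent vertices have nonzero degree, so 1/√(dᵢdⱼ) is defined where needed.
randić : ∀ {n} → Graph n → Matrix ℝ n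
randić G i j with Graph.adjacent? G i j
... | yes ij = (1/√ (degree i ℕ.* degree j)) {{ℕ.m*n≢0 _ _ {{degree-nonZero ij}} {{degree-nonZero (symmetric ij)}}}}
  where open Graph G
... | no _   = fromℚ 0ℚ

RP : ∀ {n} → Graph n → ℝ[λ]
RP G = charPoly (randić G)

-- j follows i in the cyclic order 0, 1, …, n-1, 0.
Next : ∀ {n} → Rel (Fin n) 0ℓ
Next {n} i j = suc (toℕ i) ≡ toℕ j ⊎ (suc (toℕ i) ≡ n × toℕ j ≡ 0)

next? : ∀ {n} → Decidable (Next {n})
next? {n} i j = (suc (toℕ i) ℕ.≟ toℕ j) ⊎-dec ((suc (toℕ i) ℕ.≟ n) ×-dec (toℕ j ℕ.≟ 0))

cycle : ∀ n → 3 ℕ.≤ n → Graph n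
cycle n 3≤n = record
  { Adj       = λ i j → Next i j ⊎ Next j i
  ; adjacent? = λ i j → next? i j ⊎-dec next? j i
  ; symmetric = λ { (inj₁ ij) → inj₂ ij ; (inj₂ ji) → inj₁ ji }
  ; loopless  = λ { refl (inj₁ ii) → ¬next-self ii ; refl (inj₂ ii) → ¬next-self ii }
  }
  where
  ¬next-self : ∀ {i : Fin n} → Next i i → ⊥
  ¬next-self (inj₁ eq)         = ℕ.1+n≢n eq
  ¬next-self (inj₂ (si≡n , i≡0)) =
    contradiction (subst (3 ℕ.≤_) (trans (sym si≡n) (cong suc i≡0)) 3≤n) λ { (ℕ.s≤s ()) }

-- The indexing starts at 1; the value at 0 is a dummy.
Λ : ℕ → ℝ[λ]
Λ 0 = 0#
Λ 1 = λ′
Λ 2 = λ′ ^ 2 - const (fromℚ (+ 1 ℚ./ 4))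
Λ (suc (suc (suc k))) = λ′ * Λ (suc (suc k)) - const (fromℚ (+ 1 ℚ./ 4)) * Λ (suc k)

{-# OPTIONS --safe #-}

-- Every vertex of the cycle has degree 2, so λI - R(C_n) has λ on the diagonal
-- and -½ = -1/√(2·2) at adjacent pairs.  Expanding its determinant along the first
-- row and then along the first column, both of which vanish outside vertex 0 and its
-- two neighbours, leaves minors of the tridiagonal matrix of the path 1, …, n-1: the
-- path itself (Λ_{n-1}), the path with one end vertex deleted (twice Λ_{n-2}), and the
-- two minors in which opposite ends of rows and columns are deleted; these are
-- triangular with constant diagonal -½.

module Submission where

open import Defs hiding (_≈_; _+_; _*_; -_; _-_; _^_; 0#; 1#)
open import Algebra.Bundles using (CommutativeRing; RawRing)
import Algebra.Definitions.RawSemiring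
import Algebra.Properties.CommutativeSemiring.Exp
import Algebra.Properties.Ring
import Algebra.Properties.Semiring.Exp
import Algebra.Properties.Semiring.Sum
import Algebra.Solver.Ring.NaturalCoefficients.Default
open import Algebra.Structures using (IsCommutativeRing)
open import Data.Bool.Base using (true; false)
open import Data.Fin.Base as Fin using (Fin; toℕ; fromℕ; fromℕ<; inject₁; punchIn; punchOut)
import Data.Fin.Properties as Fin
open import Data.Integer.Base using (+_)
open import Data.List.Base as List using ([]; _∷_)
open import Data.Nat.Base as ℕ using (ℕ; zero; suc; _≤_; _∸_; s≤s)
import Data.Nat.Properties as ℕ
open import Data.Nat.Tactic.RingSolver using (solve-∀)
open import Data.Product.Base using (∃; _,_; proj₂)
open import Data.Rational.Base as ℚ using (0ℚ; 1ℚ; ½; ∣_∣)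
import Data.Rational.Properties as ℚ
open import Data.Rational.Solver using (module +-*-Solver)
open import Data.Sum.Base using (_⊎_; inj₁; inj₂)
open import Data.Vec.Base as Vec using (count; tabulate)
open import Function.Base using (_∘_; id)
open import Relation.Binary.PropositionalEquality as ≡ using (_≡_; _≢_; cong; subst)
import Relation.Binary.Reasoning.Setoid
open import Relation.Nullary.Decidable using (yes; no; does; dec-true; dec-false)
open import Relation.Nullary.Negation using (¬_; contradiction)
open import Relation.Unary using (Pred; Decidable)

-- Determinants of cyclic matrices

-- Deleting the last row or column renumbers nothing. This identifies the minors of the cyclic
-- matrix that lose their last row or column with matrices given by `tri`.
toℕ-punchIn-last : ∀ n (i : Fin n) → toℕ (punchIn (fromℕ n) i) ≡ toℕ i
toℕ-punchIn-last (suc n) Fin.zero    = ≡.refl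
toℕ-punchIn-last (suc n) (Fin.suc i) = cong suc (toℕ-punchIn-last n i)

-- Λ with λ and ¼ replaced by arbitrary ring elements; the value at 0 is a dummy.
module ΛRecurrence {a ℓ} (R : RawRing a ℓ) where

  open RawRing R
  open Algebra.Definitions.RawSemiring rawSemiring using (_^_)

  Λ-like : Carrier → Carrier → ℕ → Carrier
  Λ-like x q 0                   = 0#
  Λ-like x q 1                   = x
  Λ-like x q 2                   = x ^ 2 + - q
  Λ-like x q (suc (suc (suc k))) = x * Λ-like x q (suc (suc k)) + - (q * Λ-like x q (suc k))

module CyclicDeterminant {a ℓ} (R : RawRing a ℓ)
  (isCommutativeRing : IsCommutativeRing (RawRing._≈_ R) (RawRing._+_ R) (RawRing._*_ R)
                                         (RawRing.-_ R) (RawRing.0# R) (RawRing.1# R)) where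

  open RawRing R

  commutativeRing : CommutativeRing a ℓ
  commutativeRing = record { isCommutativeRing = isCommutativeRing }

  open CommutativeRing commutativeRing
    hiding (Carrier; _≈_; _+_; _*_; -_; 0#; 1#; rawRing; +-rawMonoid; *-rawMonoid; isCommutativeRing)
  open Determinant R using (det)
  open ΛRecurrence R using (Λ-like)
  open Algebra.Properties.CommutativeSemiring.Exp commutativeSemiring using (^-distrib-*)
  open Algebra.Properties.Ring ring using (-1*x≈-x; -‿distribˡ-*; -‿distribʳ-*; -‿involutive; -‿+-comm)
  open Algebra.Definitions.RawSemiring rawSemiring using (_^_)
  open Algebra.Properties.Semiring.Exp semiring using (^-congˡ)
  open Algebra.Properties.Semiring.Sum semiring
  open Algebra.Solver.Ring.NaturalCoefficients.Default commutativeSemiring using (solve; _:=_; _:+_; _:*_; con)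
  open Relation.Binary.Reasoning.Setoid setoid

  private
    s = - 1#

  sum-single : ∀ {n} (f : Fin (suc n) → Carrier) i → (∀ j → j ≢ i → f j ≈ 0#) → sum f ≈ f i
  sum-single {n} f i f≈0 = begin
    sum f                      ≈⟨ sum-remove {i = i} f ⟩
    f i + sum (f ∘ punchIn i)  ≈⟨ +-congˡ (sum-cong-≋ λ j → f≈0 (punchIn i j) (Fin.punchInᵢ≢i i j)) ⟩
    f i + sum {n} (λ _ → 0#)   ≈⟨ +-congˡ (sum-replicate-zero n) ⟩
    f i + 0#                   ≈⟨ +-identityʳ (f i) ⟩
    f i                        ∎

  sum-ends : ∀ {n} (f : Fin (suc (suc n)) → Carrier) →
             (∀ j → j ≢ Fin.zero → j ≢ fromℕ (suc n) → f j ≈ 0#) →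
             sum f ≈ f Fin.zero + f (fromℕ (suc n))
  sum-ends {n} f f≈0 =
    +-congˡ (sum-single (f ∘ Fin.suc) (fromℕ n) λ j j≢ → f≈0 (Fin.suc j) (λ ()) (j≢ ∘ Fin.suc-injective))

  det-cong : ∀ {n} {A B : Matrix Carrier n} → (∀ i j → A i j ≈ B i j) → det A ≈ det B
  det-cong {zero}  A≈B = refl
  det-cong {suc n} A≈B = sum-cong-≋ λ j →
    *-cong (*-congˡ {s ^ toℕ j} (A≈B Fin.zero j)) (det-cong λ r c → A≈B (Fin.suc r) (punchIn j c))

  -- By induction. The terms at index zero agree definitionally. In the others, expanding each
  -- first-row minor along its first column gives a double sum over `i` and `j` whose summand
  -- contains `D i j`, the minor without rows `0`, `i + 1` and columns `0`, `j + 1`. Signs and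
  -- entries enter symmetrically, so the sums can be exchanged.
  det-expandColumn : ∀ {n} (A : Matrix Carrier (suc n)) →
    det A ≈ sum λ i → s ^ toℕ i * A i Fin.zero * det (λ r c → A (punchIn i r) (Fin.suc c))
  det-expandColumn {zero}  A = refl
  det-expandColumn {suc n} A = +-congˡ (begin
    sum (λ j → s * s ^ toℕ j * u j * det (λ r c → A (Fin.suc r) (punchIn (Fin.suc j) c)))
      ≈⟨ sum-cong-≋ (λ j → *-congˡ {s * s ^ toℕ j * u j} (det-expandColumn λ r c → A (Fin.suc r) (punchIn (Fin.suc j) c))) ⟩
    sum (λ j → s * s ^ toℕ j * u j * sum (λ i → s ^ toℕ i * v i * D i j))
      ≈⟨ sum-cong-≋ (λ j → *-distribˡ-sum (s * s ^ toℕ j * u j) λ i → s ^ toℕ i * v i * D i j) ⟩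
    sum (λ j → sum λ i → s * s ^ toℕ j * u j * (s ^ toℕ i * v i * D i j))
      ≈⟨ ∑-comm (λ j i → s * s ^ toℕ j * u j * (s ^ toℕ i * v i * D i j)) ⟩
    sum (λ i → sum λ j → s * s ^ toℕ j * u j * (s ^ toℕ i * v i * D i j))
      ≈⟨ sum-cong-≋ (λ i → sum-cong-≋ λ j → swap s (s ^ toℕ j) (u j) (s ^ toℕ i) (v i) (D i j)) ⟩
    sum (λ i → sum λ j → s * s ^ toℕ i * v i * (s ^ toℕ j * u j * D i j))
      -- The inner sum is now, by definition, the first-row expansion of the minor left after
      -- deleting row `i + 1` and column `0`.
      ≈⟨ sum-cong-≋ (λ i → *-distribˡ-sum (s * s ^ toℕ i * v i) λ j → s ^ toℕ j * u j * D i j) ⟨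
    sum (λ i → s * s ^ toℕ i * v i * det (λ r c → A (punchIn (Fin.suc i) r) (Fin.suc c)))  ∎)
    where
    u = λ j → A Fin.zero (Fin.suc j)
    v = λ i → A (Fin.suc i) Fin.zero
    D = λ i j → det λ r c → A (Fin.suc (punchIn i r)) (Fin.suc (punchIn j c))
    swap : ∀ s p u q v d → s * p * u * (q * v * d) ≈ s * q * v * (p * u * d)
    swap = solve 6 (λ s p u q v d → s :* p :* u :* (q :* v :* d) := s :* q :* v :* (p :* u :* d)) refl

  sign² : ∀ n → s ^ n * s ^ n ≈ 1#
  sign² n = begin
    s ^ n * s ^ n  ≈⟨ ^-distrib-* s s n ⟨
    (s * s) ^ n    ≈⟨ ^-congˡ n (trans (-1*x≈-x s) (-‿involutive 1#)) ⟩
    1# ^ n         ≈⟨ one n ⟩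
    1#             ∎
    where
    one : ∀ n → 1# ^ n ≈ 1#
    one zero    = refl
    one (suc n) = trans (*-identityˡ _) (one n)

  neg-^ : ∀ c n → (- c) ^ n ≈ s ^ n * c ^ n
  neg-^ c n = trans (^-congˡ n (sym (-1*x≈-x c))) (^-distrib-* s c n)

  zero-term : ∀ {y} p d → y ≈ 0# → p * y * d ≈ 0#
  zero-term {y} p d y≈0 = begin
    p * y * d   ≈⟨ *-congʳ (*-congˡ y≈0) ⟩
    p * 0# * d  ≈⟨ *-congʳ (zeroʳ p) ⟩
    0# * d      ≈⟨ zeroˡ d ⟩
    0#          ∎

  module _ (x b : Carrier) where

    -- The argument is the distance from the diagonal minus one, hence `b` at `zero`.
    band : ℕ → Carrier
    band zero    = b
    band (suc _) = 0#

    -- Entries of the tridiagonal Toeplitz matrix, indexed by ℕ so that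
    -- deleting the first row and column is a definitional equality.
    tri : ℕ → ℕ → Carrier
    tri zero    zero    = x
    tri zero    (suc j) = band j
    tri (suc i) zero    = band i
    tri (suc i) (suc j) = tri i j

    tri-diagonal : ∀ i → tri i i ≡ x
    tri-diagonal zero    = ≡.refl
    tri-diagonal (suc i) = tri-diagonal i

    tri-super : ∀ i → tri i (suc i) ≡ b
    tri-super zero    = ≡.refl
    tri-super (suc i) = tri-super i

    tri-sub : ∀ i → tri (suc i) i ≡ b
    tri-sub zero    = ≡.refl
    tri-sub (suc i) = tri-sub i

    tri-far : ∀ i j → i ≢ j → suc i ≢ j → suc j ≢ i → tri i j ≡ 0#
    tri-far zero          zero          i≢j _    _    = contradiction ≡.refl i≢j
    tri-far zero          1             _   1≢j  _    = contradiction ≡.refl 1≢j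
    tri-far zero          (suc (suc j)) _   _    _    = ≡.refl
    tri-far 1             zero          _   _    1≢i  = contradiction ≡.refl 1≢i
    tri-far (suc (suc i)) zero          _   _    _    = ≡.refl
    tri-far (suc i)       (suc j)       i≢j si≢j sj≢i =
      tri-far i j (i≢j ∘ cong suc) (si≢j ∘ cong suc) (sj≢i ∘ cong suc)

    band-off : ∀ {i} → i ≢ 0 → band i ≈ 0#
    band-off {zero}  i≢0 = contradiction ≡.refl i≢0
    band-off {suc i} _   = refl

    private
      off : ∀ {n} {j : Fin (suc n)} → j ≢ Fin.zero → toℕ j ≢ 0
      off j≢0 = j≢0 ∘ Fin.toℕ-injective

    -- The classical continuant with constant diagonals. It takes the value `1#` at `0`, the
    -- determinant of the empty matrix, so that one recurrence holds from index 2 on.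
    continuant : ℕ → Carrier
    continuant 0             = 1#
    continuant 1             = x
    continuant (suc (suc k)) = x * continuant (suc k) - b * b * continuant k

    -- The first row contains only `x` and one `b`. The minor at that `b` has a single `b` in its
    -- first column, so a second expansion produces the factor `b * b` and drops the size by two.
    det-tri : ∀ n → det {n} (λ i j → tri (toℕ i) (toℕ j)) ≈ continuant n
    det-tri 0 = refl
    det-tri 1 = solve 1 (λ x → con 1 :* x :* con 1 :+ con 0 := x) refl x
    det-tri (suc (suc n)) = begin
      1# * x * det (λ i j → T i j) + sum {suc n} (λ j → s * s ^ toℕ j * band (toℕ j) * M j)
        ≈⟨ +-cong (*-cong (*-identityˡ x) (det-tri (suc n)))
                  (sum-single (λ j → s * s ^ toℕ j * band (toℕ j) * M j) Fin.zero λ j j≢0 →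
                     zero-term (s * s ^ toℕ j) (M j) (band-off (off j≢0))) ⟩
      x * K₁ + s * 1# * b * M Fin.zero
        ≈⟨ +-congˡ (*-congˡ M₀) ⟩
      x * K₁ + s * 1# * b * (b * K₀)
        ≈⟨ +-congˡ (solve 3 (λ s b k → s :* con 1 :* b :* (b :* k) := s :* (b :* b :* k)) refl s b K₀) ⟩
      x * K₁ + s * (b * b * K₀)
        ≈⟨ +-congˡ (-1*x≈-x _) ⟩
      x * K₁ - b * b * K₀
        ∎
      where
      K₀ = continuant n
      K₁ = continuant (suc n)
      T : Matrix Carrier (suc n)
      T i j = tri (toℕ i) (toℕ j)
      A : Fin (suc n) → Matrix Carrier (suc n)
      A j r c = tri (suc (toℕ r)) (toℕ (punchIn (Fin.suc j) c))
      M : Fin (suc n) → Carrier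
      M j = det (A j)
      D : Fin (suc n) → Carrier
      D i = det (λ r c → A Fin.zero (punchIn i r) (Fin.suc c))
      -- With column 1 deleted, the first column is still column 0, whose entries below the first
      -- row form `band`. Removing it with its top row shifts both indices of `tri` by two, which
      -- computes away.
      M₀ : M Fin.zero ≈ b * K₀
      M₀ = begin
        M Fin.zero
          ≈⟨ det-expandColumn (A Fin.zero) ⟩
        sum (λ i → s ^ toℕ i * band (toℕ i) * D i)
          ≈⟨ sum-single (λ i → s ^ toℕ i * band (toℕ i) * D i) Fin.zero (λ i i≢0 →
               zero-term (s ^ toℕ i) (D i) (band-off (off i≢0))) ⟩
        1# * b * D Fin.zero
          ≈⟨ *-cong (*-identityˡ b) (det-tri n) ⟩
        b * K₀  ∎

    -- This is the tridiagonal matrix of size `n + 1` without its last row and first column: lower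
    -- triangular with `b` on the diagonal, so each first-row expansion splits off one factor `b`.
    det-tri-dropFirstColumn : ∀ n → det {n} (λ i j → tri (toℕ i) (suc (toℕ j))) ≈ b ^ n
    det-tri-dropFirstColumn zero    = refl
    det-tri-dropFirstColumn (suc n) = begin
      sum (λ j → s ^ toℕ j * band (toℕ j) * M j)
        ≈⟨ sum-single (λ j → s ^ toℕ j * band (toℕ j) * M j) Fin.zero (λ j j≢0 →
             zero-term (s ^ toℕ j) (M j) (band-off (off j≢0))) ⟩
      1# * b * M Fin.zero
        ≈⟨ *-cong (*-identityˡ b) (det-tri-dropFirstColumn n) ⟩
      b * b ^ n  ∎
      where
      M : Fin (suc n) → Carrier
      M j = det λ r c → tri (suc (toℕ r)) (suc (toℕ (punchIn j c)))

    -- The transposed situation, upper triangular, so the expansion goes along the first column.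
    det-tri-dropFirstRow : ∀ n → det {n} (λ i j → tri (suc (toℕ i)) (toℕ j)) ≈ b ^ n
    det-tri-dropFirstRow zero    = refl
    det-tri-dropFirstRow (suc n) = begin
      det {suc n} (λ i j → tri (suc (toℕ i)) (toℕ j))
        ≈⟨ det-expandColumn {n} (λ i j → tri (suc (toℕ i)) (toℕ j)) ⟩
      sum (λ i → s ^ toℕ i * band (toℕ i) * M i)
        ≈⟨ sum-single (λ i → s ^ toℕ i * band (toℕ i) * M i) Fin.zero (λ i i≢0 →
             zero-term (s ^ toℕ i) (M i) (band-off (off i≢0))) ⟩
      1# * b * M Fin.zero
        ≈⟨ *-cong (*-identityˡ b) (det-tri-dropFirstRow n) ⟩
      b * b ^ n  ∎
      where
      M : Fin (suc n) → Carrier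
      M i = det λ r c → tri (suc (toℕ (punchIn i r))) (suc (toℕ c))

    record IsCyclic {n} (M : Matrix Carrier n) : Set ℓ where
      field
        diagonal    : ∀ i → M i i ≈ x
        adjacent    : ∀ i j → Next i j ⊎ Next j i → M i j ≈ b
        nonadjacent : ∀ i j → i ≢ j → ¬ (Next i j ⊎ Next j i) → M i j ≈ 0#

    -- Each pair of neighbours of vertex 0, one for the row expansion and one for the column
    -- expansion, contributes `b * b` times a minor. The far neighbour carries the extra sign
    -- `s ^ suc m`. It occurs not at all or squared when the two neighbours coincide, which gives
    -- the two continuants, and exactly once when they differ, which gives the two triangular
    -- minors.
    det-cyclic : ∀ m {M : Matrix Carrier (3 ℕ.+ m)} → IsCyclic M →
      det M ≈ x * continuant (2 ℕ.+ m)
            - (b * b * (continuant (1 ℕ.+ m) + continuant (1 ℕ.+ m))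
              + s ^ suc m * (b * b * (b ^ suc m + b ^ suc m)))
    det-cyclic m {M} cyclic = begin
      1# * M Fin.zero Fin.zero * det (λ r c → M (Fin.suc r) (Fin.suc c))
        + sum (λ j → s * s ^ toℕ j * u j * det (N j))
        ≈⟨ +-cong (*-cong (trans (*-identityˡ _) (diagonal Fin.zero)) (trans (det-cong inner) (det-tri (suc (suc m)))))
                  (sum-ends (λ j → s * s ^ toℕ j * u j * det (N j)) λ j j≢0 j≢l →
                    zero-term (s * s ^ toℕ j) (det (N j)) (u-off j j≢0 j≢l)) ⟩
      x * K₂ + (s * 1# * u Fin.zero * det (N Fin.zero) + s * s ^ toℕ l * u l * det (N l))
        ≈⟨ +-congˡ (+-cong (*-cong (*-congˡ u-first) (det-N Fin.zero det-00 det-l0))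
                           (*-cong (*-cong (*-congˡ {s} p-eq) u-last) (det-N l det-0l det-ll))) ⟩
      x * K₂ + (s * 1# * b * (b * K₁ + p * b * e) + s * p * b * (b * e + p * b * K₁))
        ≈⟨ +-congˡ (solve 5 (λ s p b k e →
               s :* con 1 :* b :* (b :* k :+ p :* b :* e) :+ s :* p :* b :* (b :* e :+ p :* b :* k)
            := s :* (b :* b :* (k :+ (p :* p) :* k) :+ p :* (b :* b :* (e :+ e)))) refl s p b K₁ e) ⟩
      x * K₂ + s * (b * b * (K₁ + p * p * K₁) + p * (b * b * (e + e)))
        ≈⟨ +-congˡ (*-congˡ (+-congʳ (*-congˡ (+-congˡ (trans (*-congʳ (sign² (suc m))) (*-identityˡ K₁)))))) ⟩
      x * K₂ + s * (b * b * (K₁ + K₁) + p * (b * b * (e + e)))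
        ≈⟨ +-congˡ (-1*x≈-x _) ⟩
      x * K₂ - (b * b * (K₁ + K₁) + p * (b * b * (e + e)))  ∎
      where
      open IsCyclic cyclic
      K₂ = continuant (2 ℕ.+ m)
      K₁ = continuant (1 ℕ.+ m)
      p = s ^ suc m
      e = b ^ suc m
      -- Indices here omit vertex 0, so `j` stands for vertex `j + 1`. The neighbours of vertex 0
      -- are therefore `Fin.zero` and `l`.
      l : Fin (suc (suc m))
      l = fromℕ (suc m)
      u v : Fin (suc (suc m)) → Carrier
      u j = M Fin.zero (Fin.suc j)
      v i = M (Fin.suc i) Fin.zero
      N : Fin (suc (suc m)) → Matrix Carrier (suc (suc m))
      N j r c = M (Fin.suc r) (punchIn (Fin.suc j) c)

      toℕ-l : toℕ l ≡ suc m
      toℕ-l = Fin.toℕ-fromℕ (suc m)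
      p-eq : s ^ toℕ l ≈ p
      p-eq = reflexive (cong (s ^_) toℕ-l)

      first-next : ∀ {j : Fin (suc (suc m))} → j ≢ Fin.zero → j ≢ l →
                   ¬ (Next Fin.zero (Fin.suc j) ⊎ Next (Fin.suc j) Fin.zero)
      first-next j≢0 j≢l (inj₁ (inj₁ eq)) = off j≢0 (≡.sym (ℕ.suc-injective eq))
      first-next j≢0 j≢l (inj₂ (inj₂ (eq , _))) =
        j≢l (Fin.toℕ-injective (≡.trans (ℕ.suc-injective (ℕ.suc-injective eq)) (≡.sym toℕ-l)))

      last-next : Next {3 ℕ.+ m} (Fin.suc l) Fin.zero
      last-next = inj₂ (cong (λ k → suc (suc k)) toℕ-l , ≡.refl)

      u-first : u Fin.zero ≈ b
      u-first = adjacent _ _ (inj₁ (inj₁ ≡.refl))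
      v-first : v Fin.zero ≈ b
      v-first = adjacent _ _ (inj₂ (inj₁ ≡.refl))
      u-last : u l ≈ b
      u-last = adjacent _ _ (inj₂ last-next)
      v-last : v l ≈ b
      v-last = adjacent _ _ (inj₁ last-next)
      u-off : ∀ j → j ≢ Fin.zero → j ≢ l → u j ≈ 0#
      u-off j j≢0 j≢l = nonadjacent _ _ (λ ()) (first-next j≢0 j≢l)
      v-off : ∀ i → i ≢ Fin.zero → i ≢ l → v i ≈ 0#
      v-off i i≢0 i≢l = nonadjacent _ _ (λ ())
        λ { (inj₁ h) → first-next i≢0 i≢l (inj₂ h) ; (inj₂ h) → first-next i≢0 i≢l (inj₁ h) }

      -- A wrap-around pair of `Next` always ends at vertex 0. Removing that vertex leaves only the
      -- adjacencies of a path.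
      inner : ∀ i j → M (Fin.suc i) (Fin.suc j) ≈ tri (toℕ i) (toℕ j)
      inner i j with i Fin.≟ j
      ... | yes ≡.refl = trans (diagonal _) (reflexive (≡.sym (tri-diagonal (toℕ i))))
      ... | no i≢j with suc (toℕ i) ℕ.≟ toℕ j | suc (toℕ j) ℕ.≟ toℕ i
      ...   | yes si≡j | _ = trans (adjacent _ _ (inj₁ (inj₁ (cong suc si≡j))))
                (reflexive (≡.sym (≡.trans (cong (tri (toℕ i)) (≡.sym si≡j)) (tri-super (toℕ i)))))
      ...   | no _ | yes sj≡i = trans (adjacent _ _ (inj₂ (inj₁ (cong suc sj≡i))))
                (reflexive (≡.sym (≡.trans (cong (λ k → tri k (toℕ j)) (≡.sym sj≡i)) (tri-sub (toℕ j)))))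
      ...   | no si≢j | no sj≢i = trans
                (nonadjacent _ _ (i≢j ∘ Fin.suc-injective)
                  λ { (inj₁ (inj₁ eq)) → si≢j (ℕ.suc-injective eq)
                    ; (inj₂ (inj₁ eq)) → sj≢i (ℕ.suc-injective eq) })
                (reflexive (≡.sym (tri-far (toℕ i) (toℕ j) (i≢j ∘ Fin.toℕ-injective) si≢j sj≢i)))

      minor : ∀ i j → Matrix Carrier (suc m)
      minor i j r c = M (Fin.suc (punchIn i r)) (Fin.suc (punchIn j c))

      -- Deleting column `j + 1` keeps column 0 in front, so the first column of `N j` is `v`
      -- whatever `j` is, and `v` vanishes away from the two neighbours.
      det-N : ∀ j {D₀ D₁} → det (minor Fin.zero j) ≈ D₀ → det (minor l j) ≈ D₁ →
              det (N j) ≈ b * D₀ + p * b * D₁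
      det-N j {D₀} {D₁} eq₀ eq₁ = begin
        det (N j)
          ≈⟨ det-expandColumn (N j) ⟩
        sum (λ i → s ^ toℕ i * v i * det (minor i j))
          ≈⟨ sum-ends (λ i → s ^ toℕ i * v i * det (minor i j)) (λ i i≢0 i≢l →
               zero-term (s ^ toℕ i) (det (minor i j)) (v-off i i≢0 i≢l)) ⟩
        1# * v Fin.zero * det (minor Fin.zero j) + s ^ toℕ l * v l * det (minor l j)
          ≈⟨ +-cong (*-cong (trans (*-identityˡ _) v-first) eq₀) (*-cong (*-cong p-eq v-last) eq₁) ⟩
        b * D₀ + p * b * D₁  ∎

      det-00 : det (minor Fin.zero Fin.zero) ≈ K₁
      det-00 = trans (det-cong λ r c → inner (Fin.suc r) (Fin.suc c)) (det-tri (suc m))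
      det-l0 : det (minor l Fin.zero) ≈ e
      det-l0 = trans (det-cong λ r c → trans (inner (punchIn l r) (Fin.suc c))
                        (reflexive (cong (λ k → tri k (suc (toℕ c))) (toℕ-punchIn-last (suc m) r))))
                     (det-tri-dropFirstColumn (suc m))
      det-0l : det (minor Fin.zero l) ≈ e
      det-0l = trans (det-cong λ r c → trans (inner (Fin.suc r) (punchIn l c))
                        (reflexive (cong (tri (suc (toℕ r))) (toℕ-punchIn-last (suc m) c))))
                     (det-tri-dropFirstRow (suc m))
      det-ll : det (minor l l) ≈ K₁
      det-ll = trans (det-cong λ r c → trans (inner (punchIn l r) (punchIn l c))
                        (reflexive (≡.cong₂ tri (toℕ-punchIn-last (suc m) r) (toℕ-punchIn-last (suc m) c))))
                     (det-tri (suc m))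

  -x*-x≈x*x : ∀ x → - x * - x ≈ x * x
  -x*-x≈x*x x = begin
    - x * - x      ≈⟨ -‿distribˡ-* x (- x) ⟨
    - (x * - x)    ≈⟨ -‿cong (-‿distribʳ-* x x) ⟨
    - (- (x * x))  ≈⟨ -‿involutive (x * x) ⟩
    x * x          ∎

  -- The index starts at 1 because the values at 0 differ: `1#` on the left, the dummy `0#` on the
  -- right.
  continuant≈Λ-like : ∀ {x c q} → c * c ≈ q → ∀ k → continuant x (- c) (suc k) ≈ Λ-like x q (suc k)
  continuant≈Λ-like {x} {c} {q} cc≈q = go
    where
    bb≈q : - c * - c ≈ q
    bb≈q = trans (-x*-x≈x*x c) cc≈q
    go : ∀ k → continuant x (- c) (suc k) ≈ Λ-like x q (suc k)
    go 0 = refl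
    -- The initial value `continuant 0`, a factor `1#`, is absorbed here; `x ^ 2` unfolds to
    -- `x * (x * 1#)`.
    go 1 = +-cong (*-congˡ (sym (*-identityʳ x))) (-‿cong (trans (*-identityʳ _) bb≈q))
    go (suc (suc k)) = +-cong (*-congˡ (go (suc k))) (-‿cong (*-cong bb≈q (go k)))

  -- The sign `p` from the expansion meets the same sign in the power of `- c`, and `p * p` is `1#`,
  -- so the parity of the size disappears. The doubled terms share the factor `c + c`, which is
  -- `1#`.
  det-cyclic-half : ∀ {x c q} → c + c ≈ 1# → c * c ≈ q → ∀ m {M : Matrix Carrier (3 ℕ.+ m)} →
    IsCyclic x (- c) M →
    det M ≈ x * Λ-like x q (2 ℕ.+ m) + - (c * Λ-like x q (1 ℕ.+ m)) + - (c ^ (2 ℕ.+ m))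
  det-cyclic-half {x} {c} {q} c+c≈1 cc≈q m {M} cyclic = begin
    det M
      ≈⟨ det-cyclic x (- c) m cyclic ⟩
    x * K₂ - (- c * - c * (K₁ + K₁) + p * (- c * - c * ((- c) ^ suc m + (- c) ^ suc m)))
      ≈⟨ +-congˡ (-‿cong (+-cong (*-congʳ cc) (*-congˡ (*-cong cc (+-cong (neg-^ c (suc m)) (neg-^ c (suc m))))))) ⟩
    x * K₂ - (c * c * (K₁ + K₁) + p * (c * c * (p * e + p * e)))
      ≈⟨ +-congˡ (-‿cong (solve 4 (λ c k p e →
             c :* c :* (k :+ k) :+ p :* (c :* c :* (p :* e :+ p :* e))
          := (c :+ c) :* (c :* k :+ (p :* p) :* (c :* e))) refl c K₁ p e)) ⟩
    x * K₂ - (c + c) * (c * K₁ + p * p * (c * e))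
      ≈⟨ +-congˡ (-‿cong (trans (*-cong c+c≈1 (+-congˡ (trans (*-congʳ (sign² (suc m))) (*-identityˡ _))))
                                (*-identityˡ _))) ⟩
    x * K₂ - (c * K₁ + c * e)
      ≈⟨ +-congˡ (-‿+-comm (c * K₁) (c * e)) ⟨
    x * K₂ + (- (c * K₁) - c * e)
      ≈⟨ +-assoc _ _ _ ⟨
    x * K₂ - c * K₁ - c * e
      ≈⟨ +-congʳ (+-cong (*-congˡ (continuant≈Λ-like cc≈q (suc m))) (-‿cong (*-congˡ (continuant≈Λ-like cc≈q m)))) ⟩
    x * Λ-like x q (2 ℕ.+ m) - c * Λ-like x q (1 ℕ.+ m) - c * e  ∎
    where
    K₂ = continuant x (- c) (2 ℕ.+ m)
    K₁ = continuant x (- c) (1 ℕ.+ m)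
    p = s ^ suc m
    e = c ^ suc m
    cc = -x*-x≈x*x c

-- Polynomial rings

module PolynomialRing {a ℓ} (R : RawRing a ℓ)
  (isCommutativeRing : IsCommutativeRing (RawRing._≈_ R) (RawRing._+_ R) (RawRing._*_ R)
                                         (RawRing.-_ R) (RawRing.0# R) (RawRing.1# R)) where

  open RawRing R

  commutativeRing : CommutativeRing a ℓ
  commutativeRing = record { isCommutativeRing = isCommutativeRing }

  open CommutativeRing commutativeRing
    hiding (Carrier; _≈_; _+_; _*_; -_; 0#; 1#; rawRing; +-rawMonoid; *-rawMonoid; isCommutativeRing; _-_)
  open Polynomial R using (coeff; _≈ₚ_; _+ₚ_; _*ₚ_) renaming (const to constant)
  open Algebra.Properties.Ring ring using (-0#≈0#)
  open Algebra.Solver.Ring.NaturalCoefficients.Default commutativeSemiring using (solve; _:=_; _:+_; _:*_)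
  open Relation.Binary.Reasoning.Setoid setoid

  infixl 7 _⋆_
  -- The Cauchy product of formal power series. Proving the ring laws on infinite sequences avoids
  -- any case distinction on the lengths of coefficient lists.
  _⋆_ : (ℕ → Carrier) → (ℕ → Carrier) → ℕ → Carrier
  (f ⋆ g) zero    = f 0 * g 0
  (f ⋆ g) (suc k) = f 0 * g (suc k) + ((f ∘ suc) ⋆ g) k

  ⋆-cong : ∀ {f f′ g g′} → (∀ k → f k ≈ f′ k) → (∀ k → g k ≈ g′ k) → ∀ k → (f ⋆ g) k ≈ (f′ ⋆ g′) k
  ⋆-cong f≈ g≈ zero    = *-cong (f≈ 0) (g≈ 0)
  ⋆-cong f≈ g≈ (suc k) = +-cong (*-cong (f≈ 0) (g≈ (suc k))) (⋆-cong (f≈ ∘ suc) g≈ k)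

  ⋆-zeroˡ : ∀ g k → ((λ _ → 0#) ⋆ g) k ≈ 0#
  ⋆-zeroˡ g zero    = zeroˡ (g 0)
  ⋆-zeroˡ g (suc k) = trans (+-cong (zeroˡ (g (suc k))) (⋆-zeroˡ g k)) (+-identityˡ 0#)

  ⋆-distribʳ : ∀ f g h k → ((λ i → f i + g i) ⋆ h) k ≈ (f ⋆ h) k + (g ⋆ h) k
  ⋆-distribʳ f g h zero    = distribʳ (h 0) (f 0) (g 0)
  ⋆-distribʳ f g h (suc k) = trans (+-congˡ (⋆-distribʳ (f ∘ suc) (g ∘ suc) h k))
    (solve 5 (λ a b c p q → (a :+ b) :* c :+ (p :+ q) := a :* c :+ p :+ (b :* c :+ q)) refl
      (f 0) (g 0) (h (suc k)) (((f ∘ suc) ⋆ h) k) (((g ∘ suc) ⋆ h) k))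

  ⋆-scale : ∀ c f g k → ((λ i → c * f i) ⋆ g) k ≈ c * (f ⋆ g) k
  ⋆-scale c f g zero    = *-assoc c (f 0) (g 0)
  ⋆-scale c f g (suc k) = trans (+-cong (*-assoc c (f 0) (g (suc k))) (⋆-scale c (f ∘ suc) g k))
    (sym (distribˡ c (f 0 * g (suc k)) (((f ∘ suc) ⋆ g) k)))

  -- The definition peels terms off the left factor; peeling them off the right one is what closes
  -- the induction for commutativity.
  ⋆-unfoldʳ : ∀ f g k → (f ⋆ g) (suc k) ≈ f (suc k) * g 0 + (f ⋆ (g ∘ suc)) k
  ⋆-unfoldʳ f g zero    = +-comm (f 0 * g 1) (f 1 * g 0)
  ⋆-unfoldʳ f g (suc k) = trans (+-congˡ (⋆-unfoldʳ (f ∘ suc) g k))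
    (solve 3 (λ a b c → a :+ (b :+ c) := b :+ (a :+ c)) refl
      (f 0 * g (suc (suc k))) (f (suc (suc k)) * g 0) (((f ∘ suc) ⋆ (g ∘ suc)) k))

  ⋆-comm : ∀ f g k → (f ⋆ g) k ≈ (g ⋆ f) k
  ⋆-comm f g zero    = *-comm (f 0) (g 0)
  ⋆-comm f g (suc k) = begin
    f 0 * g (suc k) + ((f ∘ suc) ⋆ g) k  ≈⟨ +-cong (*-comm _ _) (⋆-comm (f ∘ suc) g k) ⟩
    g (suc k) * f 0 + (g ⋆ (f ∘ suc)) k  ≈⟨ ⋆-unfoldʳ g f k ⟨
    (g ⋆ f) (suc k)                      ∎

  ⋆-assoc : ∀ f g h k → ((f ⋆ g) ⋆ h) k ≈ (f ⋆ (g ⋆ h)) k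
  ⋆-assoc f g h zero    = *-assoc (f 0) (g 0) (h 0)
  ⋆-assoc f g h (suc k) = begin
    -- The tail of `f ⋆ g` is by definition a multiple of the tail of `g` plus the product of the
    -- tail of `f` with `g`, so linearity in the left factor applies.
    f 0 * g 0 * h (suc k) + ((λ i → f 0 * g (suc i) + ((f ∘ suc) ⋆ g) i) ⋆ h) k
      ≈⟨ +-congˡ (⋆-distribʳ (λ i → f 0 * g (suc i)) ((f ∘ suc) ⋆ g) h k) ⟩
    f 0 * g 0 * h (suc k) + (((λ i → f 0 * g (suc i)) ⋆ h) k + (((f ∘ suc) ⋆ g) ⋆ h) k)
      ≈⟨ +-congˡ (+-cong (⋆-scale (f 0) (g ∘ suc) h k) (⋆-assoc (f ∘ suc) g h k)) ⟩
    f 0 * g 0 * h (suc k) + (f 0 * ((g ∘ suc) ⋆ h) k + ((f ∘ suc) ⋆ (g ⋆ h)) k)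
      ≈⟨ solve 5 (λ a b c p q → a :* b :* c :+ (a :* p :+ q) := a :* (b :* c :+ p) :+ q) refl
           (f 0) (g 0) (h (suc k)) (((g ∘ suc) ⋆ h) k) (((f ∘ suc) ⋆ (g ⋆ h)) k) ⟩
    f 0 * (g 0 * h (suc k) + ((g ∘ suc) ⋆ h) k) + ((f ∘ suc) ⋆ (g ⋆ h)) k  ∎

  coeff-+ : ∀ p q k → coeff (p +ₚ q) k ≈ coeff p k + coeff q k
  coeff-+ []      q       k       = sym (+-identityˡ _)
  coeff-+ (a ∷ p) []      k       = sym (+-identityʳ _)
  coeff-+ (a ∷ p) (b ∷ q) zero    = refl
  coeff-+ (a ∷ p) (b ∷ q) (suc k) = coeff-+ p q k

  -- The hypothesis on `0#` handles the indices past the end of the list.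
  coeff-map : ∀ {f} → f 0# ≈ 0# → ∀ p k → coeff (List.map f p) k ≈ f (coeff p k)
  coeff-map f0≈0 []      k       = sym f0≈0
  coeff-map f0≈0 (a ∷ p) zero    = refl
  coeff-map f0≈0 (a ∷ p) (suc k) = coeff-map f0≈0 p k

  coeff-neg : ∀ p k → coeff (List.map -_ p) k ≈ - coeff p k
  coeff-neg = coeff-map -0#≈0#

  -- Through this, the multiplicative laws of polynomials follow from those of `_⋆_`.
  coeff-* : ∀ p q k → coeff (p *ₚ q) k ≈ (coeff p ⋆ coeff q) k
  coeff-* []      q k = sym (⋆-zeroˡ (coeff q) k)
  coeff-* (a ∷ p) q k = begin
    coeff (List.map (a *_) q +ₚ (0# ∷ (p *ₚ q))) k
      ≈⟨ coeff-+ (List.map (a *_) q) (0# ∷ (p *ₚ q)) k ⟩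
    coeff (List.map (a *_) q) k + coeff (0# ∷ (p *ₚ q)) k
      ≈⟨ +-congʳ (coeff-map (zeroʳ a) q k) ⟩
    a * coeff q k + coeff (0# ∷ (p *ₚ q)) k
      ≈⟨ shift k ⟩
    (coeff (a ∷ p) ⋆ coeff q) k  ∎
    where
    shift : ∀ k → a * coeff q k + coeff (0# ∷ (p *ₚ q)) k ≈ (coeff (a ∷ p) ⋆ coeff q) k
    shift zero    = +-identityʳ _
    shift (suc k) = +-congˡ (coeff-* p q k)

  constant-⋆ : ∀ c f k → (coeff (constant c) ⋆ f) k ≈ c * f k
  constant-⋆ c f zero    = refl
  constant-⋆ c f (suc k) = trans (+-congˡ (⋆-zeroˡ f k)) (+-identityʳ _)

  constant-cong : ∀ {c d} → c ≈ d → constant c ≈ₚ constant d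
  constant-cong c≈d zero    = c≈d
  constant-cong c≈d (suc k) = refl

  private
    +-lift : ∀ p q {f g : ℕ → Carrier} → (∀ k → coeff p k ≈ f k) → (∀ k → coeff q k ≈ g k) →
             ∀ k → coeff (p +ₚ q) k ≈ f k + g k
    +-lift p q p≈ q≈ k = trans (coeff-+ p q k) (+-cong (p≈ k) (q≈ k))

    *-lift : ∀ p q {f g : ℕ → Carrier} → (∀ k → coeff p k ≈ f k) → (∀ k → coeff q k ≈ g k) →
             ∀ k → coeff (p *ₚ q) k ≈ (f ⋆ g) k
    *-lift p q p≈ q≈ k = trans (coeff-* p q k) (⋆-cong p≈ q≈ k)

    *-comm′ : ∀ p q → p *ₚ q ≈ₚ q *ₚ p
    *-comm′ p q k = trans (coeff-* p q k) (trans (⋆-comm (coeff p) (coeff q) k) (sym (coeff-* q p k)))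

    *-identityˡ′ : ∀ p → constant 1# *ₚ p ≈ₚ p
    *-identityˡ′ p k = trans (coeff-* (constant 1#) p k)
      (trans (constant-⋆ 1# (coeff p) k) (*-identityˡ (coeff p k)))

    distribʳ′ : ∀ p q r → (q +ₚ r) *ₚ p ≈ₚ q *ₚ p +ₚ r *ₚ p
    distribʳ′ p q r k = begin
      coeff ((q +ₚ r) *ₚ p) k                          ≈⟨ *-lift (q +ₚ r) p (coeff-+ q r) (λ _ → refl) k ⟩
      ((λ i → coeff q i + coeff r i) ⋆ coeff p) k      ≈⟨ ⋆-distribʳ (coeff q) (coeff r) (coeff p) k ⟩
      (coeff q ⋆ coeff p) k + (coeff r ⋆ coeff p) k    ≈⟨ +-lift (q *ₚ p) (r *ₚ p) (coeff-* q p) (coeff-* r p) k ⟨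
      coeff (q *ₚ p +ₚ r *ₚ p) k                       ∎

  +ₚ-cong : ∀ {p p′ q q′} → p ≈ₚ p′ → q ≈ₚ q′ → p +ₚ q ≈ₚ p′ +ₚ q′
  +ₚ-cong {p} {p′} {q} {q′} p≈ q≈ k = trans (+-lift p q p≈ q≈ k) (sym (coeff-+ p′ q′ k))

  polynomial-isCommutativeRing : IsCommutativeRing _≈ₚ_ _+ₚ_ _*ₚ_ (List.map -_) [] (constant 1#)
  polynomial-isCommutativeRing = record
    { isRing = record
      { +-isAbelianGroup = record
        { isGroup = record
          { isMonoid = record
            { isSemigroup = record
              { isMagma = record
                { isEquivalence = record
                  { refl  = λ k → refl
                  ; sym   = λ p≈q k → sym (p≈q k)
                  ; trans = λ p≈q q≈r k → trans (p≈q k) (q≈r k)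
                  }
                ; ∙-cong = λ {p} {p′} {q} {q′} → +ₚ-cong {p} {p′} {q} {q′}
                }
              ; assoc = λ p q r k → trans (+-lift (p +ₚ q) r (coeff-+ p q) (λ _ → refl) k)
                  (trans (+-assoc _ _ _) (sym (+-lift p (q +ₚ r) (λ _ → refl) (coeff-+ q r) k)))
              }
            ; identity = (λ p k → refl)
                       , (λ p k → trans (coeff-+ p [] k) (+-identityʳ _))
            }
          ; inverse = (λ p k → trans (+-lift (List.map -_ p) p (coeff-neg p) (λ _ → refl) k) (-‿inverseˡ _))
                    , (λ p k → trans (+-lift p (List.map -_ p) (λ _ → refl) (coeff-neg p) k) (-‿inverseʳ _))
          ; ⁻¹-cong = λ {p} {q} p≈q k → trans (coeff-neg p k) (trans (-‿cong (p≈q k)) (sym (coeff-neg q k)))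
          }
        ; comm = λ p q k → trans (coeff-+ p q k) (trans (+-comm _ _) (sym (coeff-+ q p k)))
        }
      ; *-cong = λ {p} {p′} {q} {q′} p≈ q≈ k → trans (*-lift p q p≈ q≈ k) (sym (coeff-* p′ q′ k))
      ; *-assoc = λ p q r k → trans (*-lift (p *ₚ q) r (coeff-* p q) (λ _ → refl) k)
          (trans (⋆-assoc (coeff p) (coeff q) (coeff r) k) (sym (*-lift p (q *ₚ r) (λ _ → refl) (coeff-* q r) k)))
      ; *-identity = *-identityˡ′
                   , (λ p k → trans (*-comm′ p (constant 1#) k) (*-identityˡ′ p k))
      ; distrib = (λ p q r k → trans (*-comm′ p (q +ₚ r) k) (trans (distribʳ′ p q r k)
                    (+ₚ-cong {q *ₚ p} {p *ₚ q} {r *ₚ p} {p *ₚ r} (*-comm′ q p) (*-comm′ r p) k)))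
                , distribʳ′
      }
    ; *-comm = *-comm′
    }

-- Real numbers

-- Operations on reals act termwise, so this transfers the equational ring laws from the rationals.
≗⇒≈ᴿ : ∀ {x y} → (∀ n → seq x n ≡ seq y n) → x ≈ᴿ y
≗⇒≈ᴿ {x} {y} x≗y ε ε>0 = 0 , λ n _ → subst (λ t → ∣ t ∣ <ᵠ ε)
  (≡.sym (≡.trans (cong (ℚ._- seq y n) (x≗y n)) (ℚ.+-inverseʳ (seq y n)))) ε>0

≈ᴿ-sym : ∀ {x y} → x ≈ᴿ y → y ≈ᴿ x
≈ᴿ-sym {x} {y} x≈y ε ε>0 with x≈y ε ε>0
... | N , h = N , λ n n≥ → subst (_<ᵠ ε)
  (≡.trans (≡.sym (ℚ.∣-p∣≡∣p∣ (seq x n ℚ.- seq y n)))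
    (cong ∣_∣ (solve 2 (λ a b → :- (a :- b) := b :- a) ≡.refl (seq x n) (seq y n))))
  (h n n≥)
  where open +-*-Solver

∣∣-split : ∀ {p q r ε} → p ℚ.+ q ≡ r → ∣ p ∣ <ᵠ ½ ℚ.* ε → ∣ q ∣ <ᵠ ½ ℚ.* ε → ∣ r ∣ <ᵠ ε
∣∣-split {p} {q} {ε = ε} ≡.refl p< q< =
  ℚ.≤-<-trans (ℚ.∣p+q∣≤∣p∣+∣q∣ p q) (subst (_ <ᵠ_) (halves ε) (ℚ.+-mono-< p< q<))

≈ᴿ-trans : ∀ {x y z} → x ≈ᴿ y → y ≈ᴿ z → x ≈ᴿ z
≈ᴿ-trans {x} {y} {z} x≈y y≈z ε ε>0 with x≈y _ (half-pos ε>0) | y≈z _ (half-pos ε>0)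
... | N , h | M , k = N ℕ.⊔ M , λ n n≥ →
  ∣∣-split {seq x n ℚ.- seq y n} {seq y n ℚ.- seq z n}
    (solve 3 (λ a b c → (a :- b) :+ (b :- c) := a :- c) ≡.refl (seq x n) (seq y n) (seq z n))
    (h n (ℕ.m⊔n≤o⇒m≤o N M n≥)) (k n (ℕ.m⊔n≤o⇒n≤o N M n≥))
  where open +-*-Solver

+ᴿ-cong : ∀ {x x′ y y′} → x ≈ᴿ x′ → y ≈ᴿ y′ → x +ᴿ y ≈ᴿ x′ +ᴿ y′
+ᴿ-cong {x} {x′} {y} {y′} x≈ y≈ ε ε>0 with x≈ _ (half-pos ε>0) | y≈ _ (half-pos ε>0)
... | N , h | M , k = N ℕ.⊔ M , λ n n≥ →
  ∣∣-split {seq x n ℚ.- seq x′ n} {seq y n ℚ.- seq y′ n}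
    (solve 4 (λ a b c d → (a :- c) :+ (b :- d) := (a :+ b) :- (c :+ d)) ≡.refl
      (seq x n) (seq y n) (seq x′ n) (seq y′ n))
    (h n (ℕ.m⊔n≤o⇒m≤o N M n≥)) (k n (ℕ.m⊔n≤o⇒n≤o N M n≥))
  where open +-*-Solver

-- The difference of the products is x(y - y′) + y′(x - x′), so bounds `B` on `x` and `C` on `y′`
-- suffice, with `δ` equal to `ε` divided by `B + C`.
*ᴿ-cong : ∀ {x x′ y y′} → x ≈ᴿ x′ → y ≈ᴿ y′ → x *ᴿ y ≈ᴿ x′ *ᴿ y′
*ᴿ-cong {x} {x′} {y} {y′} x≈ y≈ ε ε>0 =
  let B , B>0 , N₁ , hB = bounded x
      C , C>0 , N₂ , hC = bounded y′
      δ , δ>0 , total   = quotient {B ℚ.+ C} {ε} (+-pos B>0 C>0) ε>0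
      N₃ , h = x≈ δ δ>0
      N₄ , k = y≈ δ δ>0
  in (N₁ ℕ.⊔ N₂) ℕ.⊔ (N₃ ℕ.⊔ N₄) , λ n n≥ →
    let n≥₁₂ = ℕ.m⊔n≤o⇒m≤o (N₁ ℕ.⊔ N₂) (N₃ ℕ.⊔ N₄) n≥
        n≥₃₄ = ℕ.m⊔n≤o⇒n≤o (N₁ ℕ.⊔ N₂) (N₃ ℕ.⊔ N₄) n≥
    in subst (∣ seq x n ℚ.* seq y n ℚ.- seq x′ n ℚ.* seq y′ n ∣ <ᵠ_) total
         (*-close {seq x n} {seq y n} {seq x′ n} {seq y′ n} B>0 C>0
           (hB n (ℕ.m⊔n≤o⇒m≤o N₁ N₂ n≥₁₂)) (hC n (ℕ.m⊔n≤o⇒n≤o N₁ N₂ n≥₁₂))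
           (h n (ℕ.m⊔n≤o⇒m≤o N₃ N₄ n≥₃₄)) (k n (ℕ.m⊔n≤o⇒n≤o N₃ N₄ n≥₃₄)))

-ᴿ-cong : ∀ {x y} → x ≈ᴿ y → -ᴿ x ≈ᴿ -ᴿ y
-ᴿ-cong {x} {y} x≈y ε ε>0 with x≈y ε ε>0
... | N , h = N , λ n n≥ → subst (_<ᵠ ε)
  (≡.trans (≡.sym (ℚ.∣-p∣≡∣p∣ (seq x n ℚ.- seq y n)))
    (cong ∣_∣ (ℚ.neg-distrib-+ (seq x n) (ℚ.- seq y n))))
  (h n n≥)

ℝ-isCommutativeRing : IsCommutativeRing _≈ᴿ_ _+ᴿ_ _*ᴿ_ -ᴿ_ (fromℚ 0ℚ) (fromℚ 1ℚ)
ℝ-isCommutativeRing = record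
  { isRing = record
    { +-isAbelianGroup = record
      { isGroup = record
        { isMonoid = record
          { isSemigroup = record
            { isMagma = record
              { isEquivalence = record
                { refl  = λ {x} → ≗⇒≈ᴿ {x} {x} λ _ → ≡.refl
                ; sym   = λ {x} {y} → ≈ᴿ-sym {x} {y}
                ; trans = λ {x} {y} {z} → ≈ᴿ-trans {x} {y} {z}
                }
              ; ∙-cong = λ {x} {x′} {y} {y′} → +ᴿ-cong {x} {x′} {y} {y′}
              }
            ; assoc = λ x y z → ≗⇒≈ᴿ {(x +ᴿ y) +ᴿ z} {x +ᴿ (y +ᴿ z)} λ n → ℚ.+-assoc (seq x n) (seq y n) (seq z n)
            }
          ; identity = (λ x → ≗⇒≈ᴿ {fromℚ 0ℚ +ᴿ x} {x} λ n → ℚ.+-identityˡ (seq x n))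
                     , (λ x → ≗⇒≈ᴿ {x +ᴿ fromℚ 0ℚ} {x} λ n → ℚ.+-identityʳ (seq x n))
          }
        ; inverse = (λ x → ≗⇒≈ᴿ { -ᴿ x +ᴿ x} {fromℚ 0ℚ} λ n → ℚ.+-inverseˡ (seq x n))
                  , (λ x → ≗⇒≈ᴿ {x +ᴿ -ᴿ x} {fromℚ 0ℚ} λ n → ℚ.+-inverseʳ (seq x n))
        ; ⁻¹-cong = λ {x} {y} → -ᴿ-cong {x} {y}
        }
      ; comm = λ x y → ≗⇒≈ᴿ {x +ᴿ y} {y +ᴿ x} λ n → ℚ.+-comm (seq x n) (seq y n)
      }
    ; *-cong = λ {x} {x′} {y} {y′} → *ᴿ-cong {x} {x′} {y} {y′}
    ; *-assoc = λ x y z → ≗⇒≈ᴿ {(x *ᴿ y) *ᴿ z} {x *ᴿ (y *ᴿ z)} λ n → ℚ.*-assoc (seq x n) (seq y n) (seq z n)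
    ; *-identity = (λ x → ≗⇒≈ᴿ {fromℚ 1ℚ *ᴿ x} {x} λ n → ℚ.*-identityˡ (seq x n))
                 , (λ x → ≗⇒≈ᴿ {x *ᴿ fromℚ 1ℚ} {x} λ n → ℚ.*-identityʳ (seq x n))
    ; distrib = (λ x y z → ≗⇒≈ᴿ {x *ᴿ (y +ᴿ z)} {x *ᴿ y +ᴿ x *ᴿ z} λ n → ℚ.*-distribˡ-+ (seq x n) (seq y n) (seq z n))
              , (λ x y z → ≗⇒≈ᴿ {(y +ᴿ z) *ᴿ x} {y *ᴿ x +ᴿ z *ᴿ x} λ n → ℚ.*-distribʳ-+ (seq x n) (seq y n) (seq z n))
    }
  ; *-comm = λ x y → ≗⇒≈ᴿ {x *ᴿ y} {y *ᴿ x} λ n → ℚ.*-comm (seq x n) (seq y n)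
  }

⌊√⌋-square : ∀ a → ⌊√ a ℕ.* a ⌋ ≡ a
⌊√⌋-square a = ℕ.≤-antisym
  (ℕ.≤-pred (square-cancel-< (ℕ.≤-<-trans (⌊√⌋-lower (a ℕ.* a)) (ℕ.*-mono-< (ℕ.n<1+n a) (ℕ.n<1+n a)))))
  (ℕ.≤-pred (square-cancel-< (⌊√⌋-upper (a ℕ.* a))))

-- Scaling a perfect square by `(n + 1)²` gives a perfect square again, so the integer root is exact
-- and the approximating sequence is constant.
√-seq-square : ∀ k n → √-seq (k ℕ.* k) n ≡ + k ℚ./ 1
√-seq-square k n = ≡.trans
  (cong (λ a → + a ℚ./ suc n) (≡.trans (cong ⌊√_⌋ (regroup k (suc n))) (⌊√⌋-square (k ℕ.* suc n))))
  (ℚ.≤-antisym (/-mono (k ℕ.* suc n) k n 0 (ℕ.≤-reflexive (ℕ.*-identityʳ _)))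
               (/-mono k (k ℕ.* suc n) 0 n (ℕ.≤-reflexive (≡.sym (ℕ.*-identityʳ _)))))
  where
  regroup : ∀ k N → k ℕ.* k ℕ.* (N ℕ.* N) ≡ (k ℕ.* N) ℕ.* (k ℕ.* N)
  regroup = solve-∀

-- In `randić` the radicand is a product of degrees with its own proof of being nonzero; a variable
-- `d` with `d ≡ 4` accommodates both.
1/√4≈½ : ∀ d .{{_ : ℕ.NonZero d}} → d ≡ 4 → 1/√ d ≈ᴿ fromℚ ½
1/√4≈½ _ ≡.refl = ≗⇒≈ᴿ {1/√ 4} {fromℚ ½} λ n → cong recip (√-seq-square 2 n)

-- The cycle graph

module _ {a p} {A : Set a} {P : Pred A p} (P? : Decidable P) where

  count-remove : ∀ {n} (f : Fin (suc n) → A) i → P (f i) →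
                 count P? (tabulate f) ≡ suc (count P? (tabulate (f ∘ punchIn i)))
  count-remove f Fin.zero Pfi rewrite dec-true (P? (f Fin.zero)) Pfi = ≡.refl
  count-remove {suc n} f (Fin.suc i) Pfi with does (P? (f Fin.zero))
  ... | true  = cong suc (count-remove (f ∘ Fin.suc) i Pfi)
  ... | false = count-remove (f ∘ Fin.suc) i Pfi

  count-none : ∀ {n} (f : Fin n → A) → (∀ i → ¬ P (f i)) → count P? (tabulate f) ≡ 0
  count-none {zero}  f ¬P = ≡.refl
  count-none {suc n} f ¬P rewrite dec-false (P? (f Fin.zero)) (¬P Fin.zero) = count-none (f ∘ Fin.suc) (¬P ∘ Fin.suc)

-- Remove `a`, then `b` at its position `b′` among the remaining indices; nothing that satisfies `P`
-- is left.
count-pair : ∀ {n p} {P : Pred (Fin (suc (suc n))) p} (P? : Decidable P) {a b} → a ≢ b → P a → P b →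
             (∀ {j} → P j → j ≡ a ⊎ j ≡ b) → count P? (Vec.allFin (suc (suc n))) ≡ 2
count-pair {n} {P = P} P? {a} {b} a≢b Pa Pb only = ≡.trans (count-remove P? id a Pa) (cong suc
  (≡.trans (count-remove P? (punchIn a) b′ (subst P (≡.sym a↑b′≡b) Pb))
    (cong suc (count-none P? (punchIn a ∘ punchIn b′) none))))
  where
  b′ = punchOut a≢b
  a↑b′≡b = Fin.punchIn-punchOut a≢b
  none : ∀ i → ¬ P (punchIn a (punchIn b′ i))
  none i Pi with only Pi
  ... | inj₁ eq = Fin.punchInᵢ≢i a _ eq
  ... | inj₂ eq = Fin.punchInᵢ≢i b′ i (Fin.punchIn-injective a _ _ (≡.trans eq (≡.sym a↑b′≡b)))

next-exists : ∀ {n} (i : Fin (suc n)) → ∃ (Next i)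
next-exists {n} i with suc (toℕ i) ℕ.≟ suc n
... | yes eq = Fin.zero , inj₂ (eq , ≡.refl)
... | no ¬eq = fromℕ< i<n , inj₁ (≡.sym (Fin.toℕ-fromℕ< i<n))
  where i<n = ℕ.≤∧≢⇒< (Fin.toℕ<n i) ¬eq

prev-exists : ∀ {n} (j : Fin (suc n)) → ∃ λ i → Next i j
prev-exists {n} Fin.zero    = fromℕ n , inj₂ (cong suc (Fin.toℕ-fromℕ n) , ≡.refl)
prev-exists     (Fin.suc k) = inject₁ k , inj₁ (cong suc (Fin.toℕ-inject₁ k))

next-unique : ∀ {n} {i j k : Fin n} → Next i j → Next i k → j ≡ k
next-unique (inj₁ ij) (inj₁ ik) = Fin.toℕ-injective (≡.trans (≡.sym ij) ik)
next-unique {j = j} (inj₁ ij) (inj₂ (i≡n , _)) = contradiction (≡.trans (≡.sym ij) i≡n) (ℕ.<⇒≢ (Fin.toℕ<n j))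
next-unique {k = k} (inj₂ (i≡n , _)) (inj₁ ik) = contradiction (≡.trans (≡.sym ik) i≡n) (ℕ.<⇒≢ (Fin.toℕ<n k))
next-unique (inj₂ (_ , j≡0)) (inj₂ (_ , k≡0)) = Fin.toℕ-injective (≡.trans j≡0 (≡.sym k≡0))

prev-unique : ∀ {n} {i j k : Fin n} → Next i k → Next j k → i ≡ j
prev-unique (inj₁ ik) (inj₁ jk) = Fin.toℕ-injective (ℕ.suc-injective (≡.trans ik (≡.sym jk)))
prev-unique (inj₁ ik) (inj₂ (_ , k≡0)) = contradiction (≡.trans ik k≡0) λ ()
prev-unique (inj₂ (_ , k≡0)) (inj₁ jk) = contradiction (≡.trans jk k≡0) λ ()
prev-unique (inj₂ (i≡n , _)) (inj₂ (j≡n , _)) = Fin.toℕ-injective (ℕ.suc-injective (≡.trans i≡n (≡.sym j≡n)))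

-- Two steps forward return to the start only on a cycle of length 1 or 2. Hence the two neighbours
-- of a vertex are distinct and its degree is 2. In `go`, no wrap-around would mean that `i + 2`
-- equals `i`, one wrap-around that `n` is 2, and two that `n` is 1.
next-asym : ∀ {n} → 3 ≤ n → {i j : Fin n} → Next i j → ¬ Next j i
next-asym 3≤n {i} {j} ij ji = go ij ji
  where
  two : ∀ {i j : Fin _} → suc (toℕ i) ≡ toℕ j → suc (toℕ j) ≡ _ → toℕ i ≡ 0 → 3 ≤ 2
  two ij j≡n i≡0 = subst (3 ≤_) (≡.trans (≡.sym j≡n) (cong suc (≡.trans (≡.sym ij) (cong suc i≡0)))) 3≤n
  go : Next i j → ¬ Next j i
  go (inj₁ ij)         (inj₁ ji)         = ℕ.m+1+n≢n 1 (≡.trans (cong suc ij) ji)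
  go (inj₁ ij)         (inj₂ (j≡n , i≡0)) = contradiction (two {i} {j} ij j≡n i≡0) λ { (s≤s (s≤s ())) }
  go (inj₂ (i≡n , j≡0)) (inj₁ ji)         = contradiction (two {j} {i} ji i≡n j≡0) λ { (s≤s (s≤s ())) }
  go (inj₂ (i≡n , _))   (inj₂ (_ , i≡0))  =
    contradiction (subst (3 ≤_) (≡.trans (≡.sym i≡n) (cong suc i≡0)) 3≤n) λ { (s≤s ()) }

degree-cycle : ∀ m (3≤n : 3 ≤ 3 ℕ.+ m) i → Graph.degree (cycle (3 ℕ.+ m) 3≤n) i ≡ 2
degree-cycle m 3≤n i = count-pair (Graph.adjacent? (cycle (3 ℕ.+ m) 3≤n) i)
  (λ a≡b → next-asym 3≤n ia (subst (λ k → Next k i) (≡.sym a≡b) bi))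
  (inj₁ ia) (inj₂ bi)
  λ { (inj₁ ij) → inj₁ (next-unique ij ia) ; (inj₂ ji) → inj₂ (prev-unique ji bi) }
  where
  ia = proj₂ (next-exists i)
  bi = proj₂ (prev-exists i)

randić-adjacent : ∀ m (3≤n : 3 ≤ 3 ℕ.+ m) i j → Next i j ⊎ Next j i →
                  randić (cycle (3 ℕ.+ m) 3≤n) i j ≈ᴿ fromℚ ½
randić-adjacent m 3≤n i j adj with Graph.adjacent? (cycle (3 ℕ.+ m) 3≤n) i j
... | yes ij = 1/√4≈½ _ {{ℕ.m*n≢0 _ _ {{degree-nonZero ij}} {{degree-nonZero (symmetric ij)}}}}
  (≡.cong₂ ℕ._*_ (degree-cycle m 3≤n i) (degree-cycle m 3≤n j))
  where open Graph (cycle (3 ℕ.+ m) 3≤n)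
... | no ¬ij = contradiction adj ¬ij

randić-nonadjacent : ∀ {n} (G : Graph n) {i j} → ¬ Graph.Adj G i j → randić G i j ≡ fromℚ 0ℚ
randić-nonadjacent G {i} {j} ¬ij with Graph.adjacent? G i j
... | yes ij = contradiction ij ¬ij
... | no _   = ≡.refl

-- The characteristic polynomial of the cycle

open import Defs using (_≈_; _+_; _*_; -_; _-_; _^_; 0#; 1#)
open PolynomialRing ℝ-rawRing ℝ-isCommutativeRing using (constant-cong; polynomial-isCommutativeRing)
open CyclicDeterminant ℝ[λ]-rawRing polynomial-isCommutativeRing using (IsCyclic; det-cyclic-half)
open ΛRecurrence ℝ[λ]-rawRing using (Λ-like)

private
  module P = IsCommutativeRing polynomial-isCommutativeRing

  ½ₚ ¼ₚ : ℝ[λ]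
  ½ₚ = const (fromℚ ½)
  ¼ₚ = const (fromℚ (+ 1 ℚ./ 4))

  -- The left side is a list with one zero coefficient, the right side the empty list; they agree
  -- only coefficientwise.
  const-0 : const (fromℚ 0ℚ) ≈ 0#
  const-0 zero    = ≗⇒≈ᴿ {fromℚ 0ℚ} {fromℚ 0ℚ} λ _ → ≡.refl
  const-0 (suc k) = ≗⇒≈ᴿ {fromℚ 0ℚ} {fromℚ 0ℚ} λ _ → ≡.refl

½+½≈1 : ½ₚ + ½ₚ ≈ 1#
½+½≈1 = constant-cong {fromℚ ½ +ᴿ fromℚ ½} {fromℚ 1ℚ} (≗⇒≈ᴿ {fromℚ ½ +ᴿ fromℚ ½} {fromℚ 1ℚ} λ _ → ≡.refl)

½*½≈¼ : ½ₚ * ½ₚ ≈ ¼ₚ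
½*½≈¼ zero    = ≗⇒≈ᴿ {fromℚ ½ *ᴿ fromℚ ½ +ᴿ fromℚ 0ℚ} {fromℚ (+ 1 ℚ./ 4)} λ _ → ≡.refl
½*½≈¼ (suc k) = ≗⇒≈ᴿ {fromℚ 0ℚ} {fromℚ 0ℚ} λ _ → ≡.refl

scalarMatrix-diagonal : ∀ {n} p (i : Fin n) → scalarMatrix p i i ≡ p
scalarMatrix-diagonal p i rewrite dec-true (i Fin.≟ i) ≡.refl = ≡.refl

scalarMatrix-off : ∀ {n} p {i j : Fin n} → i ≢ j → scalarMatrix p i j ≡ 0#
scalarMatrix-off p {i} {j} i≢j rewrite dec-false (i Fin.≟ j) i≢j = ≡.refl

characteristicMatrix : ∀ {n} → Graph n → Matrix ℝ[λ] n
characteristicMatrix G i j = scalarMatrix λ′ i j - const (randić G i j)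

entry : ∀ {n} (G : Graph n) i j {p r} → scalarMatrix λ′ i j ≡ p → const (randić G i j) ≈ r →
        characteristicMatrix G i j ≈ p - r
entry G i j {p} {r} ≡.refl r≈ =
  P.+-cong {p} {p} { - const (randić G i j)} { - r} (P.refl {p}) (P.-‿cong {const (randić G i j)} {r} r≈)

cyclic : ∀ m 3≤n → IsCyclic λ′ (- ½ₚ) (characteristicMatrix (cycle (3 ℕ.+ m) 3≤n))
cyclic m 3≤n = record
  { diagonal = λ i → P.trans {characteristicMatrix G i i} {λ′ - 0#} {λ′}
      (entry G i i {r = 0#} (scalarMatrix-diagonal λ′ i) (zero-entry i i (loopless ≡.refl))) (P.+-identityʳ λ′)
  -- Off the diagonal the minuend is the empty list, so `0# - r` computes to `- r`, and to `0#` when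
  -- `r` is `0#`.
  ; adjacent = λ i j ij → entry G i j {r = ½ₚ} (scalarMatrix-off λ′ λ i≡j → loopless i≡j ij)
      (constant-cong {randić G i j} {fromℚ ½} (randić-adjacent m 3≤n i j ij))
  ; nonadjacent = λ i j i≢j ¬ij → entry G i j {r = 0#} (scalarMatrix-off λ′ i≢j) (zero-entry i j ¬ij)
  }
  where
  G = cycle (3 ℕ.+ m) 3≤n
  open Graph G
  zero-entry : ∀ i j → ¬ Adj i j → const (randić G i j) ≈ 0#
  zero-entry i j ¬ij = subst (λ r → const r ≈ 0#) (≡.sym (randić-nonadjacent G ¬ij)) const-0

-- The clauses coincide at these arguments, so the two sides are identical, not merely equivalent
-- polynomials.
Λ-like≡Λ : ∀ k → Λ-like λ′ ¼ₚ k ≡ Λ k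
Λ-like≡Λ 0 = ≡.refl
Λ-like≡Λ 1 = ≡.refl
Λ-like≡Λ 2 = ≡.refl
Λ-like≡Λ (suc (suc (suc k))) =
  ≡.cong₂ (λ p q → λ′ * p - ¼ₚ * q) (Λ-like≡Λ (suc (suc k))) (Λ-like≡Λ (suc k))

-- Here and below, n, the polynomials and the indices stay abstract: at concrete
-- values conversion checking would evaluate determinants and products.
RP≡det : ∀ {n} (G : Graph n) → RP G ≡ Determinant.det ℝ[λ]-rawRing (characteristicMatrix G)
RP≡det G = ≡.refl

≈-rewrite : ∀ {r r′ x c p p′ q q′ e e′ : ℝ[λ]} → r′ ≡ r → p ≡ p′ → q ≡ q′ → e ≡ e′ →
  r ≈ x * p + - (c * q) + - e → r′ ≈ x * p′ - c * q′ - e′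
≈-rewrite ≡.refl ≡.refl ≡.refl ≡.refl r≈ = r≈

RP-cycle : ∀ m {n} (3≤n : 3 ≤ n) → n ≡ 3 ℕ.+ m →
  RP (cycle n 3≤n) ≈ λ′ * Λ (n ∸ 1) - ½ₚ * Λ (n ∸ 2) - ½ₚ ^ (n ∸ 1)
RP-cycle m 3≤n ≡.refl = ≈-rewrite {x = λ′} {c = ½ₚ}
  (RP≡det (cycle (3 ℕ.+ m) 3≤n))
  (≡.trans (Λ-like≡Λ (2 ℕ.+ m)) (cong Λ {2 ℕ.+ m} {(3 ℕ.+ m) ∸ 1} ≡.refl))
  (≡.trans (Λ-like≡Λ (1 ℕ.+ m)) (cong Λ {1 ℕ.+ m} {(3 ℕ.+ m) ∸ 2} ≡.refl))
  (cong (½ₚ ^_) {2 ℕ.+ m} {(3 ℕ.+ m) ∸ 1} ≡.refl)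
  (det-cyclic-half {λ′} {½ₚ} {¼ₚ} ½+½≈1 ½*½≈¼ m
    {characteristicMatrix (cycle (3 ℕ.+ m) 3≤n)} (cyclic m 3≤n))

theorem2 : (n : ℕ) (3≤n : 3 ≤ n) →
    RP (cycle n 3≤n) ≈
    λ′ * Λ (n ∸ 1) - const (fromℚ ½) * Λ (n ∸ 2) - const (fromℚ ½) ^ (n ∸ 1)
theorem2 n 3≤n = RP-cycle (n ∸ 3) 3≤n (≡.sym (ℕ.m+[n∸m]≡n 3≤n))
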